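{- Let $1\le t\le n$ be integers and let $\mathbb{F}$ be a finite field. Let $C$ be an unrestricted arithmetic circuit over $\mathbb{F}$ (arbitrary gates, unbounded fan-in) with $t$ inputs, consisting of the secret $s$ and $t-1$ random field elements $r_1,\dots,r_{t-1}$, and with $n$ outputs, and suppose that $C$ computes the $n$ shares of a $(t,n)$-threshold secret sharing scheme. Then: (1) the underlying directed acyclic graph of $C$ is a $(t,n)$-concentrator; (2) the graph obtained from it by removing the input vertex $s$ (together with its incident edges) is a $(t-1,n)$-concentrator.
   Context: Unrestricted arithmetic circuit over $\mathbb{F}$: a finite directed acyclic graph with designated input vertices (having no incoming edges) and designated output vertices; each non-input vertex (gate) of in-degree $k$ computes an arbitrary function $\mathbb{F}^k\to\mathbb{F}$ of the values of its in-neighbours; $k$ is unbounded. $(t,n)$-concentrator ($t\le n$): a directed acyclic graph with $t$ inputs and $n$ outputs in which for every set $T$ of $t$ outputs there are $t$ pairwise vertex-disjoint directed paths connecting $t$ distinct inputs to the vertices of $T$. Computing the shares of a $(t,n)$-threshold secret sharing scheme: let $S$ (the value at input $s$) be uniform over $\mathbb{F}$, let the values at the random inputs be uniform over $\mathbb{F}$, with all inputs mutually independent, and let $Y_1,\dots,Y_n$ be the values of the $n$ outputs (the shares). For $T\subseteq[n]$ let $Y_T=(Y_i)_{i\in T}$. It is required that $H(S\mid Y_T)=0$ for every $T\subseteq[n]$ with $|T|=t$ (correctness) and $H(S\mid Y_T)=H(S)$ for every $T\subseteq[n]$ with $|T|=t-1$ (privacy), where $H$ is Shannon entropy. -}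

module Defs where

open import Level using (Level; 0ℓ; _⊔_) renaming (suc to lsuc)
open import Algebra.Apartness.Structures using (IsHeytingField)
open import Data.Fin using (Fin; zero; suc; finToFun)
open import Data.Fin.Properties using (any?; nonZeroIndex; suc-injective; 0≢1+n) renaming (_≟_ to _≟ᶠ_)
open import Data.Fin.Induction using (spo-wellFounded)
open import Data.Fin.Subset using (Subset; _∈_; ∣_∣; _-_)
open import Data.Fin.Subset.Properties using (_∈?_; x∈p∧x≢y⇒x∈p-y)
open import Data.List as List using (List; []; _∷_; length; filter; allFin; tabulate)
open import Data.List.Properties using (≡-dec)
open import Data.List.Membership.Propositional.Properties using (∈-filter⁺; ∈-allFin; ∈-length; ∈-lookup)
open import Data.List.Relation.Binary.Disjoint.Propositional using (Disjoint)
open import Data.List.Relation.Unary.All as All using (All)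
open import Data.List.Relation.Unary.All.Properties using (all-filter; tabulate⁺)
open import Data.Nat using (ℕ; suc; _*_; _^_; _≤_; NonZero; >-nonZero; ≢-nonZero; ≢-nonZero⁻¹)
open import Data.Nat.Properties using (m^n≢0)
open import Data.Nat.ListAction using (product)
open import Data.Nat.ListAction.Properties using (product≢0)
open import Data.Product using (∃-syntax; _×_; _,_)
open import Data.Vec as Vec using (Vec)
open import Data.Vec.Properties using (tabulate-cong)
open import Function using (_∘_; Inverse; Injective; _↔_)
open import Induction.WellFounded using (WellFounded; Acc; acc)
open import Relation.Binary using (Rel; Decidable; DecidableEquality)
open import Relation.Binary.Construct.Closure.ReflexiveTransitive using (Star; ε; _◅_)
open import Relation.Binary.Construct.Closure.Transitive using (TransClosure; [_]; transitive; wellFounded⁻)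
open import Relation.Binary.PropositionalEquality using (_≡_; _≢_; refl; sym; trans; cong; resp₂; isEquivalence)
open import Relation.Nullary using (¬_; Dec; yes; no; ¬?; contradiction)
open import Relation.Nullary.Decidable using (_×-dec_; map′)

private
  variable
    a b : Level
    m k n t N : ℕ

-- Taking apartness to be ≢ makes a Heyting field a field in the usual sense
-- (0 ≢ 1 follows: 0 - 0 is invertible in the zero ring).
record FiniteField (a : Level) : Set (lsuc a) where
  infixl 7 _·_
  infixl 6 _+_
  field
    Carrier     : Set a
    _+_ _·_     : Carrier → Carrier → Carrier
    -_          : Carrier → Carrier
    0# 1#       : Carrier
    isField     : IsHeytingField _≡_ _≢_ _+_ _·_ -_ 0# 1#
    order       : ℕ
    enumeration : Carrier ↔ Fin order

  element : Fin order → Carrier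
  element = Inverse.from enumeration

  _≟_ : DecidableEquality Carrier
  x ≟ y = map′ injective (cong (Inverse.to enumeration))
               (Inverse.to enumeration x ≟ᶠ Inverse.to enumeration y)
    where
    injective : Inverse.to enumeration x ≡ Inverse.to enumeration y → x ≡ y
    injective eq = trans (sym (Inverse.strictlyInverseʳ enumeration x))
                         (trans (cong element eq) (Inverse.strictlyInverseʳ enumeration y))

------------------------------------------------------------------------
-- Graphs

-- The vertex set is a subset of a fixed finite set of labels, so that deleting
-- a vertex does not rename the remaining ones.
record DAG (m : ℕ) : Set₁ where
  infix 4 _⟶_ _⟶?_
  field
    vertices  : Subset m
    _⟶_       : Rel (Fin m) 0ℓ
    _⟶?_      : Decidable _⟶_
    endpoints : ∀ {u v} → u ⟶ v → u ∈ vertices × v ∈ vertices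
    acyclic   : ∀ {v} → ¬ TransClosure _⟶_ v v

  inNeighbours : Fin m → List (Fin m)
  inNeighbours v = filter (_⟶? v) (allFin m)

  indegree : Fin m → ℕ
  indegree v = length (inNeighbours v)

  inNeighbour : ∀ v → Fin (indegree v) → Fin m
  inNeighbour v = List.lookup (inNeighbours v)

  inNeighbour-⟶ : ∀ v j → inNeighbour v j ⟶ v
  inNeighbour-⟶ v j = All.lookup (all-filter (_⟶? v) (allFin m)) (∈-lookup j)

  ⟶-wellFounded : WellFounded _⟶_
  ⟶-wellFounded = wellFounded⁻ _⟶_ (spo-wellFounded record
    { isEquivalence = isEquivalence
    ; irrefl        = λ { refl → acyclic }
    ; trans         = transitive _⟶_
    ; <-resp-≈      = resp₂ (TransClosure _⟶_)
    })

  trail : ∀ {u v} → Star _⟶_ u v → List (Fin m)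
  trail {u} ε       = u ∷ []
  trail {u} (_ ◅ p) = u ∷ trail p

deleteVertex : Fin m → DAG m → DAG m
deleteVertex x G = record
  { vertices  = vertices - x
  ; _⟶_       = λ u v → u ⟶ v × u ≢ x × v ≢ x
  ; _⟶?_      = λ u v → (u ⟶? v) ×-dec ¬? (u ≟ᶠ x) ×-dec ¬? (v ≟ᶠ x)
  ; endpoints = λ { (e , u≢x , v≢x) → let (u∈ , v∈) = endpoints e in
                    x∈p∧x≢y⇒x∈p-y u∈ u≢x , x∈p∧x≢y⇒x∈p-y v∈ v≢x }
  ; acyclic   = acyclic ∘ embed
  }
  where
  open DAG G
  embed : ∀ {u v} → TransClosure (λ u v → u ⟶ v × u ≢ x × v ≢ x) u v →
          TransClosure _⟶_ u v
  embed [ e , _ ]                  = [ e ]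
  embed ((e , _) TransClosure.∷ p) = e TransClosure.∷ embed p

-- An output need not be a vertex of the graph: this only happens when an
-- output has been deleted.  No path reaches such an output.
record Network (t n : ℕ) : Set₁ where
  field
    {labels}          : ℕ
    graph             : DAG labels
  open DAG graph public
  field
    inputs            : Fin t → Fin labels
    inputs-injective  : Injective _≡_ _≡_ inputs
    inputs-vertices   : ∀ i → inputs i ∈ vertices
    inputs-sources    : ∀ i {u} → ¬ (u ⟶ inputs i)
    outputs           : Fin n → Fin labels
    outputs-injective : Injective _≡_ _≡_ outputs

deleteFirstInput : Network (suc k) n → Network k n
deleteFirstInput G = record
  { graph             = deleteVertex (inputs zero) graph
  ; inputs            = inputs ∘ suc
  ; inputs-injective  = λ eq → suc-injective (inputs-injective eq)
  ; inputs-vertices   = λ i → x∈p∧x≢y⇒x∈p-y (inputs-vertices (suc i))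
                          (λ eq → 0≢1+n (sym (inputs-injective eq)))
  ; inputs-sources    = λ { i (e , _) → inputs-sources (suc i) e }
  ; outputs           = outputs
  ; outputs-injective = outputs-injective
  }
  where open Network G

record DisjointPaths (G : Network t n) (T : Subset n) : Set where
  open Network G
  field
    source           : Fin t → Fin t
    source-injective : Injective _≡_ _≡_ source
    target           : Fin t → Fin n
    target-injective : Injective _≡_ _≡_ target
    target∈T         : ∀ j → target j ∈ T
    path             : ∀ j → Star _⟶_ (inputs (source j)) (outputs (target j))
    disjoint         : ∀ {i j} → i ≢ j → Disjoint (trail (path i)) (trail (path j))

IsConcentrator : Network t n → Set
IsConcentrator {t} {n} G = t ≤ n × (∀ (T : Subset n) → ∣ T ∣ ≡ t → DisjointPaths G T)

------------------------------------------------------------------------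
-- Circuits

module _ (F : FiniteField a) where
  open FiniteField F using (Carrier)

  -- The gate attached to an input vertex is never used.
  record Circuit (t n : ℕ) : Set (lsuc 0ℓ ⊔ a) where
    field
      network          : Network t n
    open Network network public
    field
      outputs-vertices : ∀ i → outputs i ∈ vertices
      gate             : ∀ v → Vec Carrier (indegree v) → Carrier

    isInput? : ∀ v → Dec (∃[ i ] inputs i ≡ v)
    isInput? v = any? (λ i → inputs i ≟ᶠ v)

    evalAcc : (Fin t → Carrier) → ∀ v → Acc _⟶_ v → Carrier
    evalAcc x v (acc rs) with isInput? v
    ... | yes (i , _) = x i
    ... | no  _       =
      gate v (Vec.tabulate λ j → evalAcc x (inNeighbour v j) (rs (inNeighbour-⟶ v j)))

    value : (Fin t → Carrier) → Fin labels → Carrier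
    value x v = evalAcc x v (⟶-wellFounded v)

    evalAcc-irrelevant : ∀ x v (p q : Acc _⟶_ v) → evalAcc x v p ≡ evalAcc x v q
    evalAcc-irrelevant x v (acc rs) (acc ss) with isInput? v
    ... | yes _ = refl
    ... | no  _ = cong (gate v) (tabulate-cong λ j →
      evalAcc-irrelevant x (inNeighbour v j) (rs (inNeighbour-⟶ v j)) (ss (inNeighbour-⟶ v j)))

    value-input : ∀ x i → value x (inputs i) ≡ x i
    value-input x i with ⟶-wellFounded (inputs i)
    ... | acc rs with isInput? (inputs i)
    ...   | yes (_ , eq) = cong x (inputs-injective eq)
    ...   | no  ¬input   = contradiction (i , refl) ¬input

    value-gate : ∀ x v → (∀ i → inputs i ≢ v) →
                 value x v ≡ gate v (Vec.tabulate (value x ∘ inNeighbour v))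
    value-gate x v ¬input with ⟶-wellFounded v
    ... | acc rs with isInput? v
    ...   | yes (i , eq) = contradiction eq (¬input i)
    ...   | no  _        = cong (gate v) (tabulate-cong λ j →
      evalAcc-irrelevant x (inNeighbour v j) (rs (inNeighbour-⟶ v j)) (⟶-wellFounded _))

------------------------------------------------------------------------
-- Entropy

-- The real number (1 / scale) · log (num / den).  Entropies of random
-- variables on a finite uniform sample space are all of this form.
record LogRational : Set where
  constructor logRational
  field
    num den scale : ℕ
    .{{num≢0}}    : NonZero num
    .{{den≢0}}    : NonZero den
    .{{scale≢0}}  : NonZero scale

-- Equality of the denoted real numbers:
-- (1/d) log (p/q) = (1/d′) log (p′/q′)  iff  (p/q)^d′ = (p′/q′)^d.
infix 4 _≃_
_≃_ : LogRational → LogRational → Set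
logRational p q d ≃ logRational p′ q′ d′ = p ^ d′ * q′ ^ d ≡ p′ ^ d * q ^ d′

0ᴸ : LogRational
0ᴸ = logRational 1 1 1

-- Random variables are functions on Fin N with the uniform distribution.
module _ .{{_ : NonZero N}} where

  -- The expectation of log (f / g).
  𝔼log : (f g : Fin N → ℕ) → (∀ ω → NonZero (f ω)) → (∀ ω → NonZero (g ω)) → LogRational
  𝔼log f g f≢0 g≢0 = logRational (product (tabulate f)) (product (tabulate g)) N
    {{product≢0 (tabulate⁺ f≢0)}} {{product≢0 (tabulate⁺ g≢0)}}

  module _ {A : Set a} (_≟_ : DecidableEquality A) (X : Fin N → A) where

    -- N · P(X = X(ω))
    count : Fin N → ℕ
    count ω = length (filter (λ ω′ → X ω′ ≟ X ω) (allFin N))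

    count≢0 : ∀ ω → NonZero (count ω)
    count≢0 ω = >-nonZero (∈-length (∈-filter⁺ (λ ω′ → X ω′ ≟ X ω) (∈-allFin ω) refl))

    -- H(X) = Σₓ P(X=x) log (1 / P(X=x)) = 𝔼[log (N / count)]
    entropy : LogRational
    entropy = 𝔼log (λ _ → N) count (λ _ → ≢-nonZero (≢-nonZero⁻¹ N)) count≢0

  module _ {A : Set a} {B : Set b} (_≟ᴬ_ : DecidableEquality A) (_≟ᴮ_ : DecidableEquality B)
           (X : Fin N → A) (Y : Fin N → B) where

    -- N · P(X = X(ω), Y = Y(ω))
    jointCount : Fin N → ℕ
    jointCount ω = length (filter (λ ω′ → (X ω′ ≟ᴬ X ω) ×-dec (Y ω′ ≟ᴮ Y ω)) (allFin N))

    jointCount≢0 : ∀ ω → NonZero (jointCount ω)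
    jointCount≢0 ω = >-nonZero (∈-length
      (∈-filter⁺ (λ ω′ → (X ω′ ≟ᴬ X ω) ×-dec (Y ω′ ≟ᴮ Y ω)) (∈-allFin ω) (refl , refl)))

    -- H(X|Y) = Σₓᵧ P(X=x,Y=y) log (P(Y=y) / P(X=x,Y=y))
    conditionalEntropy : LogRational
    conditionalEntropy = 𝔼log (count _≟ᴮ_ Y) jointCount (count≢0 _≟ᴮ_ Y) jointCount≢0

------------------------------------------------------------------------
-- Secret sharing

module _ (F : FiniteField a) (C : Circuit F (suc k) n) where
  open FiniteField F using (Carrier; order; element; 0#; enumeration; _≟_)
  open Circuit C using (value; outputs)

  -- finToFun is a bijection onto Fin (suc k) → Fin order, so under the uniform
  -- distribution on Ω the inputs are independent and uniform over the field.
  Ω : Set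
  Ω = Fin (order ^ suc k)

  instance
    ∣Ω∣≢0 : NonZero (order ^ suc k)
    ∣Ω∣≢0 = m^n≢0 order (suc k) {{nonZeroIndex (Inverse.to enumeration 0#)}}

  inputValues : Ω → Fin (suc k) → Carrier
  inputValues ω i = element (finToFun {order} {suc k} ω i)

  S : Ω → Carrier
  S ω = inputValues ω zero

  Y : Ω → Fin n → Carrier
  Y ω i = value (inputValues ω) (outputs i)

  -- The shares (Yᵢ), i ∈ T, listed by increasing i.
  Y[_] : Subset n → Ω → List Carrier
  Y[ T ] ω = List.map (Y ω) (filter (_∈? T) (allFin n))

  H[S] : LogRational
  H[S] = entropy _≟_ S

  H[S∣Y_] : Subset n → LogRational
  H[S∣Y T ] = conditionalEntropy _≟_ (≡-dec _≟_) S Y[ T ]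

  -- The threshold is suc k, the number of inputs.
  record ComputesThresholdShares : Set where
    field
      correctness : ∀ (T : Subset n) → ∣ T ∣ ≡ suc k → H[S∣Y T ] ≃ 0ᴸ
      privacy     : ∀ (T : Subset n) → ∣ T ∣ ≡ k → H[S∣Y T ] ≃ H[S]

{-# OPTIONS --safe #-}

-- By privacy the secret stays arbitrary when t - 1 shares are fixed, and by
-- correctness different secrets then give different values of any further
-- share, which hence takes every value.  Changing one share at a time, any t
-- shares take all |F|^t values; and any t - 1 shares take all values even when
-- the secret is fixed to 0.  A vertex cut smaller than the number of these
-- shares would determine them, which contradicts counting, and Menger's theorem
-- gives the disjoint paths.
--
-- Entropies enter only through their equality cases: H(X|Y) = 0 forces X to be
-- a function of Y, and H(X|Y) = H(X) forces each attained value of X to occur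
-- jointly with each attained value of Y.  Menger's theorem is obtained from
-- Hall's, by matching each vertex that is not an input to its predecessor on a
-- path.

module Submission where

open import Level using (Level)
open import Algebra.Apartness.Structures using (IsHeytingField)
open import Data.Bool using (true; false; if_then_else_)
open import Data.Empty using (⊥-elim)
open import Data.Fin using (Fin; zero; suc; combine; finToFun; fromℕ<; funToFin; punchOut)
open import Data.Fin.Properties
  using (_≟_; any?; suc-injective; injective⇒≤; finToFun-funToFin; funToFin-finToFin;
         punchOut-injective)
open import Data.Fin.Subset
  using (Subset; inside; outside; ⊤; ⁅_⁆; _∈_; _∉_; _⊆_; _∪_; _∩_; _─_; _-_; ∣_∣)
open import Data.Fin.Subset.Properties
open import Data.List as List using (List; []; _∷_; tabulate; filter; length; allFin)
open import Data.List.Membership.Propositional.Properties using (∈-tabulate⁺; ∈-filter⁺; ∈-allFin)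
open import Data.List.Properties using (≡-dec; map-cong-local; ∷-injectiveˡ; ∷-injectiveʳ)
open import Data.List.Relation.Unary.All.Properties using (all-filter)
open import Data.List.Relation.Unary.Any using (here; there)
open import Data.Nat hiding (_≟_; ∣_-_∣)
open import Data.Nat.Divisibility using (_∣_; quotient)
open import Data.Nat.Induction using (<-wellFounded)
open import Data.Nat.ListAction using (product)
open import Data.Nat.ListAction.Properties using (∈⇒∣product)
open import Data.Nat.Properties hiding (_≟_; suc-injective)
open import Data.Nat.Tactic.RingSolver using (solve-∀)
open import Data.Product using (_×_; _,_; proj₁; proj₂; ∃-syntax)
open import Data.Sum using (_⊎_; inj₁; inj₂; [_,_]′)
open import Data.Vec as Vec using ([]; _∷_; here; there)
open import Data.Vec.Functional using (updateAt)
open import Data.Vec.Functional.Properties using (updateAt-updates; updateAt-minimal)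
open import Data.Vec.Properties using (lookup⇒[]=; []=⇒lookup; lookup∘tabulate; tabulate-cong)
open import Function using (_∘_; id; Injective; Inverse)
open import Induction.WellFounded using (Acc; acc)
open import Relation.Binary using (DecidableEquality)
open import Relation.Binary.Construct.Closure.ReflexiveTransitive using (Star; ε; _◅_; _◅◅_)
open import Relation.Binary.PropositionalEquality
open import Relation.Nullary using (contradiction; yes; no; Dec; does; ¬_; ¬?)
open import Relation.Nullary.Decidable using (_×-dec_; _⊎-dec_; dec-true; dec-false; decidable-stable)
open import Relation.Unary using (Pred; Decidable)
import Data.List.Membership.Propositional as List
import Data.List.Relation.Unary.All as All

open import Algebra.Properties.Semiring.Sum +-*-semiring
  using (sum; ∑-comm; sum-cong-≗; *-distribˡ-sum; *-distribʳ-sum)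

open import Defs

-- Sums and products

∏ : ∀ {n} → (Fin n → ℕ) → ℕ
∏ f = product (tabulate f)

*-^-distrib : ∀ x y k → (x * y) ^ k ≡ x ^ k * y ^ k
*-^-distrib x y zero    = refl
*-^-distrib x y (suc k) = trans (cong (x * y *_) (*-^-distrib x y k)) (lemma x y (x ^ k) (y ^ k))
  where
  lemma : ∀ x y p q → x * y * (p * q) ≡ x * p * (y * q)
  lemma = solve-∀

^-cancelˡ-≤ : ∀ k .{{_ : NonZero k}} {x y} → x ^ k ≤ y ^ k → x ≤ y
^-cancelˡ-≤ k {x} {y} xᵏ≤yᵏ with x ≤? y
... | yes x≤y = x≤y
... | no  x≰y = contradiction xᵏ≤yᵏ (<⇒≱ (^-monoˡ-< k (≰⇒> x≰y)))

^-injectiveˡ : ∀ k .{{_ : NonZero k}} {x y} → x ^ k ≡ y ^ k → x ≡ y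
^-injectiveˡ k eq = ≤-antisym (^-cancelˡ-≤ k (≤-reflexive eq)) (^-cancelˡ-≤ k (≤-reflexive (sym eq)))

-- The inequality of arithmetic and geometric means

2xy≤x²+y² : ∀ x y → 2 * (x * y) ≤ x * x + y * y
2xy≤x²+y² x y with ≤-total x y
... | inj₁ x≤y with d , refl ← m≤n⇒∃[o]m+o≡n x≤y =
  ≤-trans (m≤m+n _ (d * d)) (≤-reflexive (lemma x d))
  where
  lemma : ∀ x d → 2 * (x * (x + d)) + d * d ≡ x * x + (x + d) * (x + d)
  lemma = solve-∀
... | inj₂ y≤x with d , refl ← m≤n⇒∃[o]m+o≡n y≤x =
  ≤-trans (m≤m+n _ (d * d)) (≤-reflexive (lemma y d))
  where
  lemma : ∀ y d → 2 * ((y + d) * y) + d * d ≡ (y + d) * (y + d) + y * y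
  lemma = solve-∀

-- The tangent of x ↦ xᵏ⁺¹ at r lies below the graph:
-- xᵏ⁺¹ ≥ rᵏ⁺¹ + (k + 1) rᵏ (x - r), without the subtraction.
tangent-≤ : ∀ k x r → suc k * (x * r ^ k) ≤ x ^ suc k + k * r ^ suc k
tangent-≤ zero    x r = ≤-reflexive (lemma x)
  where
  lemma : ∀ x → 1 * (x * 1) ≡ x * 1 + 0
  lemma = solve-∀
-- Adding `k * (x * (r * p))` makes the left side a multiple of `2 * (x * r)`; bounding the latter
-- by `x * x + r * r` brings out `x` times the left side of the induction hypothesis.
tangent-≤ (suc k) x r = +-cancelˡ-≤ (k * (x * (r * r ^ k))) _ _ (begin
  k * (x * (r * p)) + suc (suc k) * (x * (r * p))    ≡⟨ lemma₁ k x r p ⟩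
  suc k * p * (2 * (x * r))                          ≤⟨ *-monoʳ-≤ (suc k * p) (2xy≤x²+y² x r) ⟩
  suc k * p * (x * x + r * r)                        ≡⟨ lemma₂ k x r p ⟩
  x * (suc k * (x * p)) + suc k * (r * (r * p))      ≤⟨ +-monoˡ-≤ _ (*-monoʳ-≤ x (tangent-≤ k x r)) ⟩
  x * (x ^ suc k + k * (r * p)) + suc k * (r * (r * p)) ≡⟨ lemma₃ k x r p (x ^ suc k) ⟩
  k * (x * (r * p)) + (x * x ^ suc k + suc k * (r * (r * p))) ∎)
  where
  open ≤-Reasoning
  p = r ^ k
  lemma₁ : ∀ k x r p → k * (x * (r * p)) + suc (suc k) * (x * (r * p)) ≡ suc k * p * (2 * (x * r))
  lemma₁ = solve-∀
  lemma₂ : ∀ k x r p → suc k * p * (x * x + r * r) ≡ x * (suc k * (x * p)) + suc k * (r * (r * p))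
  lemma₂ = solve-∀
  lemma₃ : ∀ k x r p y → x * (y + k * (r * p)) + suc k * (r * (r * p)) ≡
                         k * (x * (r * p)) + (x * y + suc k * (r * (r * p)))
  lemma₃ = solve-∀

-- The tangent inequality at `r`, evaluated at `n * x + y`: once `n * r ^ suc n` is added, the left
-- side equals `suc n * ((n * x + y) * r ^ n)`.
weighted-AM-GM : ∀ n x y → suc n ^ suc n * (x ^ n * y) ≤ (n * x + y) ^ suc n
weighted-AM-GM n x y = +-cancelʳ-≤ (n * r ^ suc n) _ _ (begin
  suc n ^ suc n * (x ^ n * y) + n * (r * r ^ n)
    ≡⟨ cong (λ z → suc n ^ suc n * (x ^ n * y) + n * (r * z)) (*-^-distrib (suc n) x n) ⟩
  suc n * c * (p * y) + n * (suc n * x * (c * p))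
    ≡⟨ lemma n x y p c ⟩
  suc n * ((n * x + y) * (c * p))
    ≡⟨ cong (λ z → suc n * ((n * x + y) * z)) (*-^-distrib (suc n) x n) ⟨
  suc n * ((n * x + y) * r ^ n)
    ≤⟨ tangent-≤ n (n * x + y) r ⟩
  (n * x + y) ^ suc n + n * r ^ suc n ∎)
  where
  open ≤-Reasoning
  r = suc n * x
  p = x ^ n
  c = suc n ^ n
  lemma : ∀ n x y p c → suc n * c * (p * y) + n * (suc n * x * (c * p)) ≡ suc n * ((n * x + y) * (c * p))
  lemma = solve-∀

-- Induction on the number of terms: multiplying by `n ^ suc n` clears the denominator in the mean
-- of the tail, and `weighted-AM-GM` is applied to `s` and `n * y`. The one-term case is separate
-- because there the factor to cancel would be 0.
AM-GM : ∀ n (f : Fin n → ℕ) → n ^ n * ∏ f ≤ sum f ^ n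
AM-GM zero          f = ≤-refl
AM-GM (suc zero)    f = ≤-reflexive (lemma (f zero))
  where
  lemma : ∀ x → 1 * (x * 1) ≡ (x + 0) * 1
  lemma = solve-∀
AM-GM (suc n@(suc _)) f = *-cancelˡ-≤ (n ^ suc n) {{m^n≢0 n (suc n)}} (begin
  n ^ suc n * (suc n ^ suc n * (y * P))     ≡⟨ lemma n (n ^ n) (suc n ^ suc n) y P ⟩
  suc n ^ suc n * (n ^ n * P * (n * y))
    ≤⟨ *-monoʳ-≤ (suc n ^ suc n) (*-monoˡ-≤ (n * y) (AM-GM n (f ∘ suc))) ⟩
  suc n ^ suc n * (s ^ n * (n * y))         ≤⟨ weighted-AM-GM n s (n * y) ⟩
  (n * s + n * y) ^ suc n
    ≡⟨ cong (_^ suc n) (trans (sym (*-distribˡ-+ n s y)) (cong (n *_) (+-comm s y))) ⟩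
  (n * (y + s)) ^ suc n                     ≡⟨ *-^-distrib n (y + s) (suc n) ⟩
  n ^ suc n * (y + s) ^ suc n               ∎)
  where
  open ≤-Reasoning
  y = f zero
  P = ∏ (f ∘ suc)
  s = sum (f ∘ suc)
  lemma : ∀ n m c y P → n * m * (c * (y * P)) ≡ c * (m * P * (n * y))
  lemma = solve-∀

∏-distrib-* : ∀ {n} (f g : Fin n → ℕ) → ∏ (λ i → f i * g i) ≡ ∏ f * ∏ g
∏-distrib-* {zero}  f g = refl
∏-distrib-* {suc n} f g = trans (cong (f zero * g zero *_) (∏-distrib-* (f ∘ suc) (g ∘ suc)))
                                (lemma (f zero) (g zero) (∏ (f ∘ suc)) (∏ (g ∘ suc)))
  where
  lemma : ∀ x y p q → x * y * (p * q) ≡ x * p * (y * q)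
  lemma = solve-∀

∏-const : ∀ n c → ∏ {n} (λ _ → c) ≡ c ^ n
∏-const zero    c = refl
∏-const (suc n) c = cong (c *_) (∏-const n c)

∏-cong : ∀ {n} {f g : Fin n → ℕ} → (∀ i → f i ≡ g i) → ∏ f ≡ ∏ g
∏-cong {zero}  eq = refl
∏-cong {suc n} eq = cong₂ _*_ (eq zero) (∏-cong (eq ∘ suc))

∏-mono-≤ : ∀ {n} {f g : Fin n → ℕ} → (∀ i → f i ≤ g i) → ∏ f ≤ ∏ g
∏-mono-≤ {zero}  le = ≤-refl
∏-mono-≤ {suc n} le = *-mono-≤ (le zero) (∏-mono-≤ (le ∘ suc))

∏≢0 : ∀ {n} (f : Fin n → ℕ) → (∀ i → NonZero (f i)) → NonZero (∏ f)
∏≢0 {zero}  f f≢0 = _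
∏≢0 {suc n} f f≢0 = m*n≢0 (f zero) _ {{f≢0 zero}} {{∏≢0 (f ∘ suc) (f≢0 ∘ suc)}}

∏-mono-< : ∀ {n} {f g : Fin n → ℕ} → (∀ i → NonZero (f i)) → (∀ i → f i ≤ g i) →
           ∀ i → f i < g i → ∏ f < ∏ g
∏-mono-< {suc n} {f} {g} f≢0 f≤g zero    lt = <-≤-trans
  (*-monoˡ-< (∏ (f ∘ suc)) {{∏≢0 (f ∘ suc) (f≢0 ∘ suc)}} lt)
  (*-monoʳ-≤ (g zero) (∏-mono-≤ (f≤g ∘ suc)))
∏-mono-< {suc n} {f} {g} f≢0 f≤g (suc i) lt = <-≤-trans
  (*-monoʳ-< (f zero) {{f≢0 zero}} (∏-mono-< (f≢0 ∘ suc) (f≤g ∘ suc) i lt))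
  (*-monoˡ-≤ (∏ (g ∘ suc)) (f≤g zero))

sum-mono-≤ : ∀ {n} {f g : Fin n → ℕ} → (∀ i → f i ≤ g i) → sum f ≤ sum g
sum-mono-≤ {zero}  le = ≤-refl
sum-mono-≤ {suc n} le = +-mono-≤ (le zero) (sum-mono-≤ (le ∘ suc))

sum-mono-< : ∀ {n} {f g : Fin n → ℕ} → (∀ i → f i ≤ g i) → ∀ i → f i < g i → sum f < sum g
sum-mono-< le zero    lt = +-mono-<-≤ lt (sum-mono-≤ (le ∘ suc))
sum-mono-< le (suc i) lt = +-mono-≤-< (le zero) (sum-mono-< (le ∘ suc) i lt)

sum-const : ∀ n c → sum {n} (λ _ → c) ≡ n * c
sum-const zero    c = refl
sum-const (suc n) c = cong (c +_) (sum-const n c)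

-- Entropy

-- The Iverson bracket, which turns counts into sums.
⟨_⟩ : ∀ {p} {P : Set p} → Dec P → ℕ
⟨ P? ⟩ = if does P? then 1 else 0

⟨⟩-true : ∀ {p} {P : Set p} (P? : Dec P) → P → ⟨ P? ⟩ ≡ 1
⟨⟩-true P? p = cong (if_then 1 else 0) (dec-true P? p)

⟨⟩-false : ∀ {p} {P : Set p} (P? : Dec P) → ¬ P → ⟨ P? ⟩ ≡ 0
⟨⟩-false P? ¬p = cong (if_then 1 else 0) (dec-false P? ¬p)

⟨⟩-mono : ∀ {p q} {P : Set p} {Q : Set q} (P? : Dec P) (Q? : Dec Q) → (P → Q) → ⟨ P? ⟩ ≤ ⟨ Q? ⟩
⟨⟩-mono (no  _) Q? P⇒Q = z≤n
⟨⟩-mono (yes p) Q? P⇒Q = ≤-reflexive (sym (⟨⟩-true Q? (P⇒Q p)))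

⟨⟩-cong : ∀ {p q} {P : Set p} {Q : Set q} (P? : Dec P) (Q? : Dec Q) → (P → Q) → (Q → P) → ⟨ P? ⟩ ≡ ⟨ Q? ⟩
⟨⟩-cong P? Q? P⇒Q Q⇒P = ≤-antisym (⟨⟩-mono P? Q? P⇒Q) (⟨⟩-mono Q? P? Q⇒P)

⟨×⟩ : ∀ {p q} {P : Set p} {Q : Set q} (P? : Dec P) (Q? : Dec Q) → ⟨ P? ×-dec Q? ⟩ ≡ ⟨ P? ⟩ * ⟨ Q? ⟩
⟨×⟩ (no  _) Q? = refl
⟨×⟩ (yes _) Q? = sym (+-identityʳ _)

⟨⟩*-cong : ∀ {p} {P : Set p} (P? : Dec P) {x y} → (P → x ≡ y) → ⟨ P? ⟩ * x ≡ ⟨ P? ⟩ * y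
⟨⟩*-cong (no  _) P⇒eq = refl
⟨⟩*-cong (yes p) P⇒eq = cong (_+ 0) (P⇒eq p)

length-filter-tabulate : ∀ {a p} {A : Set a} {P : A → Set p} (P? : ∀ x → Dec (P x)) →
  ∀ {n} (f : Fin n → A) → length (filter P? (tabulate f)) ≡ sum (λ i → ⟨ P? (f i) ⟩)
length-filter-tabulate P? {zero}  f = refl
length-filter-tabulate P? {suc n} f with does (P? (f zero))
... | true  = cong suc (length-filter-tabulate P? (f ∘ suc))
... | false = length-filter-tabulate P? (f ∘ suc)

-- Equality cases of conditional entropy

module _ {N : ℕ} .{{_ : NonZero N}} {a b : Level} {A : Set a} {B : Set b}
         (_≟ᴬ_ : DecidableEquality A) (_≟ᴮ_ : DecidableEquality B)
         (X : Fin N → A) (Y : Fin N → B) where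

  private
    cX cY cXY : Fin N → ℕ
    cX  = count _≟ᴬ_ X
    cY  = count _≟ᴮ_ Y
    cXY = jointCount _≟ᴬ_ _≟ᴮ_ X Y

    -- A pair of values is represented by two sample points, `ω₁` attaining the first and `ω₂` the
    -- second, so that pairs of values can be summed over `Fin N` twice.
    joint? : ∀ ω₁ ω₂ ω → Dec (X ω ≡ X ω₁ × Y ω ≡ Y ω₂)
    joint? ω₁ ω₂ ω = (X ω ≟ᴬ X ω₁) ×-dec (Y ω ≟ᴮ Y ω₂)

    -- The equation is turned round so that a term here times one of `cY-sum` is the bracket of
    -- `joint? ω₁ ω₂ ω`.
    cX-sum : ∀ ω → cX ω ≡ sum (λ ω₁ → ⟨ X ω ≟ᴬ X ω₁ ⟩)
    cX-sum ω = trans (length-filter-tabulate (λ ω₁ → X ω₁ ≟ᴬ X ω) id)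
                     (sum-cong-≗ λ ω₁ → ⟨⟩-cong (X ω₁ ≟ᴬ X ω) (X ω ≟ᴬ X ω₁) sym sym)

    cY-sum : ∀ ω → cY ω ≡ sum (λ ω₂ → ⟨ Y ω ≟ᴮ Y ω₂ ⟩)
    cY-sum ω = trans (length-filter-tabulate (λ ω₂ → Y ω₂ ≟ᴮ Y ω) id)
                     (sum-cong-≗ λ ω₂ → ⟨⟩-cong (Y ω₂ ≟ᴮ Y ω) (Y ω ≟ᴮ Y ω₂) sym sym)

    cXY-sum : ∀ ω → cXY ω ≡ sum (λ ω′ → ⟨ joint? ω ω ω′ ⟩)
    cXY-sum ω = length-filter-tabulate (joint? ω ω) id

    cXY≢0 : ∀ ω → NonZero (cXY ω)
    cXY≢0 = jointCount≢0 _≟ᴬ_ _≟ᴮ_ X Y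

    ∏cXY≢0 : NonZero (∏ cXY)
    ∏cXY≢0 = ∏≢0 cXY cXY≢0

  -- Pointwise `cXY` is at most `cY`, and zero entropy makes their products equal, so no inequality
  -- is strict. With equal `Y` but different `X`, the point `ω` would be counted in `cY ω′` and not
  -- in `cXY ω′`.
  conditionalEntropy≃0⇒determined :
    conditionalEntropy _≟ᴬ_ _≟ᴮ_ X Y ≃ 0ᴸ → ∀ {ω ω′} → Y ω ≡ Y ω′ → X ω ≡ X ω′
  conditionalEntropy≃0⇒determined H≃0 {ω} {ω′} Yω≡Yω′ with X ω ≟ᴬ X ω′
  ... | yes Xω≡Xω′ = Xω≡Xω′
  ... | no  Xω≢Xω′ = contradiction ∏≡ (<⇒≢ (∏-mono-< cXY≢0 cXY≤cY ω′ cXY<cY))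
    where
    term≤ : ∀ ω₀ ω₁ → ⟨ joint? ω₀ ω₀ ω₁ ⟩ ≤ ⟨ Y ω₁ ≟ᴮ Y ω₀ ⟩
    term≤ ω₀ ω₁ = ⟨⟩-mono (joint? ω₀ ω₀ ω₁) (Y ω₁ ≟ᴮ Y ω₀) proj₂
    sum-cY : ∀ ω₀ → cY ω₀ ≡ sum (λ ω₁ → ⟨ Y ω₁ ≟ᴮ Y ω₀ ⟩)
    sum-cY ω₀ = length-filter-tabulate (λ ω₁ → Y ω₁ ≟ᴮ Y ω₀) id
    cXY≤cY : ∀ ω₀ → cXY ω₀ ≤ cY ω₀
    cXY≤cY ω₀ = subst₂ _≤_ (sym (cXY-sum ω₀)) (sym (sum-cY ω₀)) (sum-mono-≤ (term≤ ω₀))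
    cXY<cY : cXY ω′ < cY ω′
    cXY<cY = subst₂ _<_ (sym (cXY-sum ω′)) (sym (sum-cY ω′)) (sum-mono-< (term≤ ω′) ω
      (subst₂ _<_ (sym (⟨⟩-false (joint? ω′ ω′ ω) (Xω≢Xω′ ∘ proj₁)))
                  (sym (⟨⟩-true (Y ω ≟ᴮ Y ω′) Yω≡Yω′)) ≤-refl))
    ∏≡ : ∏ cXY ≡ ∏ cY
    ∏≡ = begin
      ∏ cXY              ≡⟨ *-identityʳ _ ⟨
      ∏ cXY ^ 1          ≡⟨ *-identityˡ _ ⟨
      1 * ∏ cXY ^ 1      ≡⟨ cong (_* ∏ cXY ^ 1) (^-zeroˡ N) ⟨
      1 ^ N * ∏ cXY ^ 1  ≡⟨ H≃0 ⟨
      ∏ cY ^ 1 * 1 ^ N   ≡⟨ cong (∏ cY ^ 1 *_) (^-zeroˡ N) ⟩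
      ∏ cY ^ 1 * 1       ≡⟨ *-identityʳ _ ⟩
      ∏ cY ^ 1           ≡⟨ *-identityʳ _ ⟩
      ∏ cY               ∎
      where open ≡-Reasoning

  -- With c = ∏ cXY as common denominator, weigh each ω by
  -- cX(ω) cY(ω) c / cXY(ω).  The weights sum to c times the number of pairs
  -- (ω₁, ω₂) for which (X(ω₁), Y(ω₂)) is jointly attained, whereas AM-GM and
  -- the equality of entropies force that sum to be at least c N².
  conditionalEntropy≃entropy⇒jointly-attained :
    conditionalEntropy _≟ᴬ_ _≟ᴮ_ X Y ≃ entropy _≟ᴬ_ X →
    ∀ ω₁ ω₂ → ∃[ ω ] X ω ≡ X ω₁ × Y ω ≡ Y ω₂
  conditionalEntropy≃entropy⇒jointly-attained H≃H ω₁ ω₂ with any? (joint? ω₁ ω₂)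
  ... | yes attained = attained
  ... | no ¬attained = contradiction N²c≤sum (<⇒≱ sum<N²c)
    where
    c : ℕ
    c = ∏ cXY

    c/cXY-∣ : ∀ ω → cXY ω ∣ c
    c/cXY-∣ ω = ∈⇒∣product (∈-tabulate⁺ {f = cXY} ω)

    c/cXY : Fin N → ℕ
    c/cXY ω = quotient (c/cXY-∣ ω)

    c/cXY*cXY : ∀ ω → c/cXY ω * cXY ω ≡ c
    c/cXY*cXY ω = sym (_∣_.equality (c/cXY-∣ ω))

    weight : Fin N → ℕ
    weight ω = cX ω * cY ω * c/cXY ω

    pairWeight : Fin N → Fin N → ℕ
    pairWeight ω₁ ω₂ = sum (λ ω → ⟨ joint? ω₁ ω₂ ω ⟩ * c/cXY ω)

    -- Double counting: `cX ω` and `cY ω` are expanded into brackets over `ω₁` and `ω₂`, and the sum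
    -- over `ω` is moved innermost.
    sum-weight : sum weight ≡ sum (λ ω₁ → sum (λ ω₂ → pairWeight ω₁ ω₂))
    sum-weight = begin
      sum weight
        ≡⟨ sum-cong-≗ expand ⟩
      sum (λ ω → sum (λ ω₁ → sum (λ ω₂ → ⟨ joint? ω₁ ω₂ ω ⟩ * c/cXY ω)))
        ≡⟨ ∑-comm (λ ω ω₁ → sum (λ ω₂ → ⟨ joint? ω₁ ω₂ ω ⟩ * c/cXY ω)) ⟩
      sum (λ ω₁ → sum (λ ω → sum (λ ω₂ → ⟨ joint? ω₁ ω₂ ω ⟩ * c/cXY ω)))
        ≡⟨ sum-cong-≗ (λ ω₁ → ∑-comm (λ ω ω₂ → ⟨ joint? ω₁ ω₂ ω ⟩ * c/cXY ω)) ⟩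
      sum (λ ω₁ → sum (λ ω₂ → pairWeight ω₁ ω₂)) ∎
      where
      open ≡-Reasoning
      expand : ∀ ω → weight ω ≡ sum (λ ω₁ → sum (λ ω₂ → ⟨ joint? ω₁ ω₂ ω ⟩ * c/cXY ω))
      expand ω = begin
        cX ω * cY ω * q
          ≡⟨ cong₂ (λ x y → x * y * q) (cX-sum ω) (cY-sum ω) ⟩
        sum x * sum y * q
          ≡⟨ *-assoc (sum x) (sum y) q ⟩
        sum x * (sum y * q)
          ≡⟨ *-distribʳ-sum (sum y * q) x ⟩
        sum (λ ω₁ → x ω₁ * (sum y * q))
          ≡⟨ sum-cong-≗ (λ ω₁ → trans (cong (x ω₁ *_) (*-distribʳ-sum q y))
               (*-distribˡ-sum (x ω₁) (λ ω₂ → y ω₂ * q))) ⟩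
        sum (λ ω₁ → sum (λ ω₂ → x ω₁ * (y ω₂ * q)))
          ≡⟨ sum-cong-≗ (λ ω₁ → sum-cong-≗ (λ ω₂ → trans (sym (*-assoc (x ω₁) (y ω₂) q))
               (cong (_* q) (sym (⟨×⟩ (X ω ≟ᴬ X ω₁) (Y ω ≟ᴮ Y ω₂)))))) ⟩
        sum (λ ω₁ → sum (λ ω₂ → ⟨ joint? ω₁ ω₂ ω ⟩ * q)) ∎
        where
        q = c/cXY ω
        x y : Fin N → ℕ
        x ω₁ = ⟨ X ω ≟ᴬ X ω₁ ⟩
        y ω₂ = ⟨ Y ω ≟ᴮ Y ω₂ ⟩

    pairWeight-unattained : ∀ ω₁ ω₂ → ¬ (∃[ ω ] X ω ≡ X ω₁ × Y ω ≡ Y ω₂) → pairWeight ω₁ ω₂ ≡ 0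
    pairWeight-unattained ω₁ ω₂ ¬a = begin
      pairWeight ω₁ ω₂   ≡⟨ sum-cong-≗ (λ ω → cong (_* c/cXY ω) (⟨⟩-false (joint? ω₁ ω₂ ω) (¬a ∘ (ω ,_)))) ⟩
      sum {N} (λ _ → 0)  ≡⟨ sum-const N 0 ⟩
      N * 0              ≡⟨ *-zeroʳ N ⟩
      0                  ∎
      where open ≡-Reasoning

    -- `cXY` is constant on the `cXY ω` sample points that share both values with `ω`, so these
    -- contribute equal parts of `c`. Multiplying by `cXY ω` avoids a division.
    pairWeight-attained : ∀ ω → pairWeight ω ω ≡ c
    pairWeight-attained ω = *-cancelʳ-≡ (pairWeight ω ω) c (cXY ω) {{cXY≢0 ω}} (begin
      pairWeight ω ω * cXY ω
        ≡⟨ *-distribʳ-sum (cXY ω) (λ ω′ → ⟨ joint? ω ω ω′ ⟩ * c/cXY ω′) ⟩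
      sum (λ ω′ → ⟨ joint? ω ω ω′ ⟩ * c/cXY ω′ * cXY ω)
        ≡⟨ sum-cong-≗ term ⟩
      sum (λ ω′ → ⟨ joint? ω ω ω′ ⟩ * c)
        ≡⟨ *-distribʳ-sum c (λ ω′ → ⟨ joint? ω ω ω′ ⟩) ⟨
      sum (λ ω′ → ⟨ joint? ω ω ω′ ⟩) * c
        ≡⟨ cong (_* c) (cXY-sum ω) ⟨
      cXY ω * c
        ≡⟨ *-comm (cXY ω) c ⟩
      c * cXY ω ∎)
      where
      open ≡-Reasoning
      cXY-cong : ∀ {ω ω′} → X ω′ ≡ X ω → Y ω′ ≡ Y ω → cXY ω ≡ cXY ω′
      cXY-cong {ω} {ω′} eqX eqY = trans (cXY-sum ω) (trans
        (sum-cong-≗ λ ω₀ → ⟨⟩-cong (joint? ω ω ω₀) (joint? ω′ ω′ ω₀)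
          (λ (p , q) → trans p (sym eqX) , trans q (sym eqY))
          (λ (p , q) → trans p eqX , trans q eqY))
        (sym (cXY-sum ω′)))
      term : ∀ ω′ → ⟨ joint? ω ω ω′ ⟩ * c/cXY ω′ * cXY ω ≡ ⟨ joint? ω ω ω′ ⟩ * c
      term ω′ = trans (*-assoc ⟨ joint? ω ω ω′ ⟩ (c/cXY ω′) (cXY ω))
        (⟨⟩*-cong (joint? ω ω ω′) λ (eqX , eqY) →
          trans (cong (c/cXY ω′ *_) (cXY-cong eqX eqY)) (c/cXY*cXY ω′))

    pairWeight≤c : ∀ ω₁ ω₂ → pairWeight ω₁ ω₂ ≤ c
    pairWeight≤c ω₁ ω₂ with any? (joint? ω₁ ω₂)
    ... | no ¬a                = ≤-trans (≤-reflexive (pairWeight-unattained ω₁ ω₂ ¬a)) z≤n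
    ... | yes (ω , eqX , eqY) = ≤-reflexive (trans
      (sum-cong-≗ λ ω′ → cong (_* c/cXY ω′) (⟨⟩-cong (joint? ω₁ ω₂ ω′) (joint? ω ω ω′)
        (λ (p , q) → trans p (sym eqX) , trans q (sym eqY))
        (λ (p , q) → trans p eqX , trans q eqY)))
      (pairWeight-attained ω))

    sum<N²c : sum weight < N * (N * c)
    sum<N²c = begin-strict
      sum weight                                     ≡⟨ sum-weight ⟩
      sum (λ ω₁ → sum (λ ω₂ → pairWeight ω₁ ω₂))  <⟨ sum-mono-< (λ ω₁ → sum-mono-≤ (pairWeight≤c ω₁)) ω₁
                                                          (sum-mono-< (pairWeight≤c ω₁) ω₂ pairWeight<c) ⟩
      sum {N} (λ _ → sum {N} (λ _ → c))            ≡⟨ sum-cong-≗ {N} (λ _ → sum-const N c) ⟩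
      sum {N} (λ _ → N * c)                         ≡⟨ sum-const N (N * c) ⟩
      N * (N * c)                                   ∎
      where
      open ≤-Reasoning
      pairWeight<c : pairWeight ω₁ ω₂ < c
      pairWeight<c = subst (_< c) (sym (pairWeight-unattained ω₁ ω₂ ¬attained)) (>-nonZero⁻¹ c {{∏cXY≢0}})

    -- Both entropies have scale `N`, so `H≃H` is an equality of `N`-th powers.
    ∏cY*∏cX : ∏ cY * ∏ cX ≡ N ^ N * c
    ∏cY*∏cX = ^-injectiveˡ N (begin
      (∏ cY * ∏ cX) ^ N              ≡⟨ *-^-distrib (∏ cY) (∏ cX) N ⟩
      ∏ cY ^ N * ∏ cX ^ N            ≡⟨ H≃H ⟩
      ∏ {N} (λ _ → N) ^ N * c ^ N    ≡⟨ *-^-distrib (∏ {N} (λ _ → N)) c N ⟨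
      (∏ {N} (λ _ → N) * c) ^ N      ≡⟨ cong (λ x → (x * c) ^ N) (∏-const N N) ⟩
      (N ^ N * c) ^ N                ∎)
      where open ≡-Reasoning

    -- The geometric mean of the weights is thus `N * c`: the factors `c/cXY` turn the `c` left by
    -- `∏cY*∏cX` into `c ^ N`.
    ∏weight : ∏ weight ≡ (N * c) ^ N
    ∏weight = begin
      ∏ weight                      ≡⟨ ∏-distrib-* (λ ω → cX ω * cY ω) c/cXY ⟩
      ∏ (λ ω → cX ω * cY ω) * Q     ≡⟨ cong (_* Q) (trans (∏-distrib-* cX cY) (*-comm (∏ cX) (∏ cY))) ⟩
      ∏ cY * ∏ cX * Q               ≡⟨ cong (_* Q) ∏cY*∏cX ⟩
      N ^ N * c * Q                 ≡⟨ *-assoc (N ^ N) c Q ⟩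
      N ^ N * (c * Q)
        ≡⟨ cong (N ^ N *_) (trans (*-comm c Q)
             (trans (sym (∏-distrib-* c/cXY cXY)) (∏-cong c/cXY*cXY))) ⟩
      N ^ N * ∏ {N} (λ _ → c)       ≡⟨ cong (N ^ N *_) (∏-const N c) ⟩
      N ^ N * c ^ N                 ≡⟨ *-^-distrib N c N ⟨
      (N * c) ^ N                   ∎
      where
      open ≡-Reasoning
      Q = ∏ c/cXY

    N²c≤sum : N * (N * c) ≤ sum weight
    N²c≤sum = ^-cancelˡ-≤ N (begin
      (N * (N * c)) ^ N      ≡⟨ *-^-distrib N (N * c) N ⟩
      N ^ N * (N * c) ^ N    ≡⟨ cong (N ^ N *_) ∏weight ⟨
      N ^ N * ∏ weight       ≤⟨ AM-GM N weight ⟩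
      sum weight ^ N         ∎)
      where open ≤-Reasoning

-- Subsets

fromPred : ∀ {n ℓ} {P : Pred (Fin n) ℓ} → Decidable P → Subset n
fromPred P? = Vec.tabulate (does ∘ P?)

∈-fromPred⁺ : ∀ {n ℓ} {P : Pred (Fin n) ℓ} (P? : Decidable P) {x} → P x → x ∈ fromPred P?
∈-fromPred⁺ P? {x} px = lookup⇒[]= x _ (trans (lookup∘tabulate (does ∘ P?) x) (dec-true (P? x) px))

∈-fromPred⁻ : ∀ {n ℓ} {P : Pred (Fin n) ℓ} (P? : Decidable P) {x} → x ∈ fromPred P? → P x
∈-fromPred⁻ P? {x} x∈ with P? x | trans (sym (lookup∘tabulate (does ∘ P?) x)) ([]=⇒lookup x∈)
... | yes px | _ = px

elem : ∀ {n} (p : Subset n) → Fin ∣ p ∣ → Fin n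
elem (outside ∷ p) i       = suc (elem p i)
elem (inside  ∷ p) zero    = zero
elem (inside  ∷ p) (suc i) = suc (elem p i)

elem-∈ : ∀ {n} (p : Subset n) i → elem p i ∈ p
elem-∈ (outside ∷ p) i       = there (elem-∈ p i)
elem-∈ (inside  ∷ p) zero    = here
elem-∈ (inside  ∷ p) (suc i) = there (elem-∈ p i)

elem-injective : ∀ {n} (p : Subset n) → Injective _≡_ _≡_ (elem p)
elem-injective (outside ∷ p) {i}     {j}     eq = elem-injective p (suc-injective eq)
elem-injective (inside  ∷ p) {zero}  {zero}  eq = refl
elem-injective (inside  ∷ p) {suc i} {suc j} eq = cong suc (elem-injective p (suc-injective eq))

elem-surjective : ∀ {n} (p : Subset n) {x} → x ∈ p → ∃[ i ] elem p i ≡ x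
elem-surjective (inside  ∷ p) here        = zero , refl
elem-surjective (outside ∷ p) (there x∈p) with i , eq ← elem-surjective p x∈p = i , cong suc eq
elem-surjective (inside  ∷ p) (there x∈p) with i , eq ← elem-surjective p x∈p = suc i , cong suc eq

-- Choosing a preimage of each element gives an injection of `Fin ∣ p ∣` into `Fin k`.
∣p∣≤-covered : ∀ {n k} (p : Subset n) (f : Fin k → Fin n) → (∀ {x} → x ∈ p → ∃[ i ] f i ≡ x) → ∣ p ∣ ≤ k
∣p∣≤-covered p f cover = injective⇒≤ {f = λ i → proj₁ (cover (elem-∈ p i))} λ {i} {j} eq →
  elem-injective p (trans (sym (proj₂ (cover (elem-∈ p i))))
    (trans (cong f eq) (proj₂ (cover (elem-∈ p j)))))

∣p∪q∣+∣p∩q∣≡∣p∣+∣q∣ : ∀ {n} (p q : Subset n) → ∣ p ∪ q ∣ + ∣ p ∩ q ∣ ≡ ∣ p ∣ + ∣ q ∣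
∣p∪q∣+∣p∩q∣≡∣p∣+∣q∣ []            []            = refl
∣p∪q∣+∣p∩q∣≡∣p∣+∣q∣ (outside ∷ p) (outside ∷ q) = ∣p∪q∣+∣p∩q∣≡∣p∣+∣q∣ p q
∣p∪q∣+∣p∩q∣≡∣p∣+∣q∣ (inside  ∷ p) (outside ∷ q) = cong suc (∣p∪q∣+∣p∩q∣≡∣p∣+∣q∣ p q)
∣p∪q∣+∣p∩q∣≡∣p∣+∣q∣ (outside ∷ p) (inside  ∷ q) =
  trans (cong suc (∣p∪q∣+∣p∩q∣≡∣p∣+∣q∣ p q)) (sym (+-suc ∣ p ∣ ∣ q ∣))
∣p∪q∣+∣p∩q∣≡∣p∣+∣q∣ (inside  ∷ p) (inside  ∷ q) = cong suc
  (trans (+-suc ∣ p ∪ q ∣ ∣ p ∩ q ∣) (trans (cong suc (∣p∪q∣+∣p∩q∣≡∣p∣+∣q∣ p q)) (sym (+-suc ∣ p ∣ ∣ q ∣))))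

∣p∪q∣≤∣p∣+∣q∣ : ∀ {n} (p q : Subset n) → ∣ p ∪ q ∣ ≤ ∣ p ∣ + ∣ q ∣
∣p∪q∣≤∣p∣+∣q∣ p q = ≤-trans (m≤m+n _ _) (≤-reflexive (∣p∪q∣+∣p∩q∣≡∣p∣+∣q∣ p q))

q⊆p⇒∣p─q∣+∣q∣≡∣p∣ : ∀ {n} {p q : Subset n} → q ⊆ p → ∣ p ─ q ∣ + ∣ q ∣ ≡ ∣ p ∣
q⊆p⇒∣p─q∣+∣q∣≡∣p∣ {p = []}          {[]}          q⊆p = refl
q⊆p⇒∣p─q∣+∣q∣≡∣p∣ {p = outside ∷ p} {outside ∷ q} q⊆p = q⊆p⇒∣p─q∣+∣q∣≡∣p∣ (drop-∷-⊆ q⊆p)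
q⊆p⇒∣p─q∣+∣q∣≡∣p∣ {p = outside ∷ p} {inside  ∷ q} q⊆p = contradiction (q⊆p here) λ()
q⊆p⇒∣p─q∣+∣q∣≡∣p∣ {p = inside  ∷ p} {outside ∷ q} q⊆p = cong suc (q⊆p⇒∣p─q∣+∣q∣≡∣p∣ (drop-∷-⊆ q⊆p))
q⊆p⇒∣p─q∣+∣q∣≡∣p∣ {p = inside  ∷ p} {inside  ∷ q} q⊆p =
  trans (+-suc ∣ p ─ q ∣ ∣ q ∣) (cong suc (q⊆p⇒∣p─q∣+∣q∣≡∣p∣ (drop-∷-⊆ q⊆p)))

x∈p⇒1+∣p-x∣≡∣p∣ : ∀ {n} {p : Subset n} {x} → x ∈ p → suc ∣ p - x ∣ ≡ ∣ p ∣
x∈p⇒1+∣p-x∣≡∣p∣ {p = p} {x} x∈p = begin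
  suc ∣ p - x ∣          ≡⟨ +-comm 1 _ ⟩
  ∣ p - x ∣ + 1          ≡⟨ cong (∣ p - x ∣ +_) (∣⁅x⁆∣≡1 x) ⟨
  ∣ p - x ∣ + ∣ ⁅ x ⁆ ∣  ≡⟨ q⊆p⇒∣p─q∣+∣q∣≡∣p∣ (λ y∈ → subst (_∈ p) (sym (x∈⁅y⁆⇒x≡y x y∈)) x∈p) ⟩
  ∣ p ∣                  ∎
  where open ≡-Reasoning

x∉p-x : ∀ {n} (p : Subset n) x → x ∉ p - x
x∉p-x (s ∷ p) (suc x) (there x∈) = x∉p-x p x x∈

∣p∣<n⇒∃x∉p : ∀ {n} (p : Subset n) → ∣ p ∣ < n → ∃[ x ] x ∉ p
∣p∣<n⇒∃x∉p {n} p ∣p∣<n with any? (λ x → ¬? (x ∈? p))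
... | yes x∉p = x∉p
... | no ¬x∉p = contradiction
  (≤-trans (≤-reflexive (sym (∣⊤∣≡n n))) (p⊆q⇒∣p∣≤∣q∣ {p = ⊤} {p} λ {x} _ →
    decidable-stable (x ∈? p) λ x∉p → ¬x∉p (x , x∉p)))
  (<⇒≱ ∣p∣<n)

x∉p⇒∣p∪⁅x⁆∣≡1+∣p∣ : ∀ {n} {p : Subset n} {x} → x ∉ p → ∣ p ∪ ⁅ x ⁆ ∣ ≡ suc ∣ p ∣
x∉p⇒∣p∪⁅x⁆∣≡1+∣p∣ {p = p} {x} x∉p = ≤-antisym
  (≤-trans (∣p∪q∣≤∣p∣+∣q∣ p ⁅ x ⁆) (≤-reflexive (trans (cong (∣ p ∣ +_) (∣⁅x⁆∣≡1 x)) (+-comm ∣ p ∣ 1))))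
  (p⊂q⇒∣p∣<∣q∣ (x∈p∪q⁺ ∘ inj₁ , x , x∈p∪q⁺ (inj₂ (x∈⁅x⁆ x)) , x∉p))

-- Hall's theorem

module _ {m n : ℕ} where

  private
    adjacent? : ∀ (R : Fin m → Subset n) X y → Dec (∃[ x ] x ∈ X × y ∈ R x)
    adjacent? R X y = any? λ x → (x ∈? X) ×-dec (y ∈? R x)

  neighbourhood : (Fin m → Subset n) → Subset m → Subset n
  neighbourhood R X = fromPred (adjacent? R X)

  neighbourhood⁺ : ∀ R {X x y} → x ∈ X → y ∈ R x → y ∈ neighbourhood R X
  neighbourhood⁺ R {X} x∈X y∈Rx = ∈-fromPred⁺ (adjacent? R X) (_ , x∈X , y∈Rx)

  neighbourhood⁻ : ∀ R X {y} → y ∈ neighbourhood R X → ∃[ x ] x ∈ X × y ∈ R x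
  neighbourhood⁻ R X = ∈-fromPred⁻ (adjacent? R X)

  HallCondition : (Fin m → Subset n) → Subset m → Set
  HallCondition R L = ∀ X → X ⊆ L → ∣ X ∣ ≤ ∣ neighbourhood R X ∣

  record Matching (R : Fin m → Subset n) (L : Subset m) : Set where
    field
      partner           : ∀ x → x ∈ L → Fin n
      partner-∈         : ∀ x x∈L → partner x x∈L ∈ R x
      partner-injective : ∀ {x x′} x∈L x′∈L → partner x x∈L ≡ partner x′ x′∈L → x ≡ x′

  HallCondition⊎violation : ∀ R L → HallCondition R L ⊎ (∃[ X ] X ⊆ L × ∣ neighbourhood R X ∣ < ∣ X ∣)
  HallCondition⊎violation R L with anySubset? (λ X → (X ⊆? L) ×-dec (∣ neighbourhood R X ∣ <? ∣ X ∣))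
  ... | yes violation = inj₂ violation
  ... | no ¬violation = inj₁ λ X X⊆L → ≮⇒≥ λ lt → ¬violation (X , X⊆L , lt)

  removeEdge : (Fin m → Subset n) → Fin m → Fin n → Fin m → Subset n
  removeEdge R x y = updateAt R x (_- y)

  removeEdge-∈ : ∀ R x y {v z} → z ∈ R v → (v ≡ x → z ≢ y) → z ∈ removeEdge R x y v
  removeEdge-∈ R x y {v} {z} z∈Rv z≢y with v ≟ x
  ... | yes refl = subst (z ∈_) (sym (updateAt-updates x R)) (x∈p∧x≢y⇒x∈p-y z∈Rv (z≢y refl))
  ... | no  v≢x  = subst (z ∈_) (sym (updateAt-minimal v x R v≢x)) z∈Rv

  removeEdge-⊆ : ∀ R x y v → removeEdge R x y v ⊆ R v
  removeEdge-⊆ R x y v z∈ with v ≟ x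
  ... | yes refl = p─q⊆p (R x) ⁅ y ⁆ (subst (_ ∈_) (updateAt-updates x R) z∈)
  ... | no  v≢x  = subst (_ ∈_) (updateAt-minimal v x R v≢x) z∈

  -- Rado: if deleting each of two edges at x violated Hall's condition, say
  -- on X₁ and on X₂, then it would already fail on X₁ ∪ X₂ or on (X₁ ∩ X₂) - x,
  -- by submodularity of the size of the neighbourhood.
  removeEdge-HallCondition : ∀ {R L} → HallCondition R L → ∀ {x y₁ y₂} → y₁ ≢ y₂ →
    HallCondition (removeEdge R x y₁) L ⊎ HallCondition (removeEdge R x y₂) L
  removeEdge-HallCondition {R} {L} hall {x} {y₁} {y₂} y₁≢y₂
    with HallCondition⊎violation (removeEdge R x y₁) L | HallCondition⊎violation (removeEdge R x y₂) L
  ... | inj₁ hall₁ | _ = inj₁ hall₁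
  ... | inj₂ _     | inj₁ hall₂ = inj₂ hall₂
  ... | inj₂ (X₁ , X₁⊆L , viol₁) | inj₂ (X₂ , X₂⊆L , viol₂) = contradiction ∪≤ (<⇒≱ ∪<)
    where
    R₁ R₂ : Fin m → Subset n
    R₁ = removeEdge R x y₁
    R₂ = removeEdge R x y₂

    N₁ N₂ : Subset n
    N₁ = neighbourhood R₁ X₁
    N₂ = neighbourhood R₂ X₂

    A B : Subset m
    A = X₁ - x
    B = X₂ - x

    -- Edges away from `x` are untouched, so a violating set without `x` would already violate
    -- Hall's condition for `R`.
    x∈violation : ∀ y X → X ⊆ L → ∣ neighbourhood (removeEdge R x y) X ∣ < ∣ X ∣ → x ∈ X
    x∈violation y X X⊆L viol = decidable-stable (x ∈? X) λ x∉X →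
      <⇒≱ viol (≤-trans (hall X X⊆L) (p⊆q⇒∣p∣≤∣q∣ λ z∈ →
        let (v , v∈X , z∈Rv) = neighbourhood⁻ R X z∈ in
        neighbourhood⁺ (removeEdge R x y) v∈X
          (removeEdge-∈ R x y z∈Rv λ { refl → contradiction v∈X x∉X })))

    x∈X₁ : x ∈ X₁
    x∈X₁ = x∈violation y₁ X₁ X₁⊆L viol₁
    x∈X₂ : x ∈ X₂
    x∈X₂ = x∈violation y₂ X₂ X₂⊆L viol₂

    -- Since `x` lies in both `X₁` and `X₂`, its edge to `y₁` is still available in `R₂`, and its
    -- other edges in `R₁`.
    ∪-⊆ : neighbourhood R (X₁ ∪ X₂) ⊆ N₁ ∪ N₂
    ∪-⊆ {z} z∈ with neighbourhood⁻ R (X₁ ∪ X₂) z∈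
    ... | v , v∈ , z∈Rv with v ≟ x | z ≟ y₁ | x∈p∪q⁻ X₁ X₂ v∈
    ... | yes refl | yes refl | _ =
      x∈p∪q⁺ (inj₂ (neighbourhood⁺ R₂ x∈X₂ (removeEdge-∈ R x y₂ z∈Rv λ _ → y₁≢y₂)))
    ... | yes refl | no z≢y₁  | _ =
      x∈p∪q⁺ (inj₁ (neighbourhood⁺ R₁ x∈X₁ (removeEdge-∈ R x y₁ z∈Rv λ _ → z≢y₁)))
    ... | no v≢x   | _ | inj₁ v∈X₁ =
      x∈p∪q⁺ (inj₁ (neighbourhood⁺ R₁ v∈X₁ (removeEdge-∈ R x y₁ z∈Rv λ eq → contradiction eq v≢x)))
    ... | no v≢x   | _ | inj₂ v∈X₂ =
      x∈p∪q⁺ (inj₂ (neighbourhood⁺ R₂ v∈X₂ (removeEdge-∈ R x y₂ z∈Rv λ eq → contradiction eq v≢x)))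

    ∩-⊆ : neighbourhood R (A ∩ B) ⊆ N₁ ∩ N₂
    ∩-⊆ {z} z∈ with neighbourhood⁻ R (A ∩ B) z∈
    ... | v , v∈ , z∈Rv with x∈p∩q⁻ A B v∈
    ... | v∈A , v∈B = x∈p∩q⁺
      ( neighbourhood⁺ R₁ (p─q⊆p X₁ ⁅ x ⁆ v∈A)
          (removeEdge-∈ R x y₁ z∈Rv λ { refl → contradiction v∈A (x∉p-x X₁ x) })
      , neighbourhood⁺ R₂ (p─q⊆p X₂ ⁅ x ⁆ v∈B)
          (removeEdge-∈ R x y₂ z∈Rv λ { refl → contradiction v∈A (x∉p-x X₁ x) }))

    ∪≤ : ∣ X₁ ∪ X₂ ∣ ≤ ∣ A ∪ B ∣
    ∪≤ = +-cancelʳ-≤ ∣ A ∩ B ∣ _ _ (begin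
      ∣ X₁ ∪ X₂ ∣ + ∣ A ∩ B ∣
        ≤⟨ +-mono-≤ (hall (X₁ ∪ X₂) ([ X₁⊆L , X₂⊆L ]′ ∘ x∈p∪q⁻ X₁ X₂))
                    (hall (A ∩ B) (X₁⊆L ∘ p─q⊆p X₁ ⁅ x ⁆ ∘ proj₁ ∘ x∈p∩q⁻ A B)) ⟩
      ∣ neighbourhood R (X₁ ∪ X₂) ∣ + ∣ neighbourhood R (A ∩ B) ∣
        ≤⟨ +-mono-≤ (p⊆q⇒∣p∣≤∣q∣ ∪-⊆) (p⊆q⇒∣p∣≤∣q∣ ∩-⊆) ⟩
      ∣ N₁ ∪ N₂ ∣ + ∣ N₁ ∩ N₂ ∣
        ≡⟨ ∣p∪q∣+∣p∩q∣≡∣p∣+∣q∣ N₁ N₂ ⟩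
      ∣ N₁ ∣ + ∣ N₂ ∣
        -- The strict violation and `∣ X₁ ∣ = suc ∣ A ∣` give `∣ N₁ ∣ ≤ ∣ A ∣`; likewise for `N₂`
        -- and `B`.
        ≤⟨ +-mono-≤ (s≤s⁻¹ (subst (∣ N₁ ∣ <_) (sym (x∈p⇒1+∣p-x∣≡∣p∣ x∈X₁)) viol₁))
                    (s≤s⁻¹ (subst (∣ N₂ ∣ <_) (sym (x∈p⇒1+∣p-x∣≡∣p∣ x∈X₂)) viol₂)) ⟩
      ∣ A ∣ + ∣ B ∣
        ≡⟨ ∣p∪q∣+∣p∩q∣≡∣p∣+∣q∣ A B ⟨
      ∣ A ∪ B ∣ + ∣ A ∩ B ∣ ∎)
      where open ≤-Reasoning

    ∪< : ∣ A ∪ B ∣ < ∣ X₁ ∪ X₂ ∣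
    ∪< = p⊂q⇒∣p∣<∣q∣
      ( x∈p∪q⁺ ∘ [ inj₁ ∘ p─q⊆p X₁ ⁅ x ⁆ , inj₂ ∘ p─q⊆p X₂ ⁅ x ⁆ ]′ ∘ x∈p∪q⁻ A B
      , x , x∈p∪q⁺ (inj₁ x∈X₁) , [ x∉p-x X₁ x , x∉p-x X₂ x ]′ ∘ x∈p∪q⁻ A B )

  -- Edges at vertices with two neighbours are deleted one at a time, preserving Hall's condition.
  -- The number of edges drops until no vertex has two neighbours.
  hall : ∀ {R L} → HallCondition R L → Matching R L
  hall {R} {L} = go R (<-wellFounded _)
    where
    Branching : (Fin m → Subset n) → Set
    Branching R = ∃[ x ] ∃[ y₁ ] ∃[ y₂ ] y₁ ≢ y₂ × y₁ ∈ R x × y₂ ∈ R x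

    branching? : ∀ R → Dec (Branching R)
    branching? R = any? λ x → any? λ y₁ → any? λ y₂ → ¬? (y₁ ≟ y₂) ×-dec (y₁ ∈? R x) ×-dec (y₂ ∈? R x)

    removeEdge-< : ∀ R {x y} → y ∈ R x → sum (∣_∣ ∘ removeEdge R x y) < sum (∣_∣ ∘ R)
    removeEdge-< R {x} {y} y∈Rx = sum-mono-< (λ v → p⊆q⇒∣p∣≤∣q∣ (removeEdge-⊆ R x y v)) x
      (subst (λ p → ∣ p ∣ < ∣ R x ∣) (sym (updateAt-updates x R)) (x∈p⇒∣p-x∣<∣p∣ y∈Rx))

    widen : ∀ {R x y} → Matching (removeEdge R x y) L → Matching R L
    widen {R} {x} {y} M = record
      { partner           = partner
      ; partner-∈         = λ v v∈L → removeEdge-⊆ R x y v (partner-∈ v v∈L)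
      ; partner-injective = partner-injective
      }
      where open Matching M

    -- Hall's condition on a singleton provides a neighbour, which is the only one; on a pair it
    -- forbids the two from sharing theirs.
    nonbranching : ∀ R → ¬ Branching R → HallCondition R L → Matching R L
    nonbranching R ¬branching cond = record
      { partner           = λ x x∈L → proj₁ (choice x x∈L)
      ; partner-∈         = λ x x∈L → proj₂ (choice x x∈L)
      ; partner-injective = injective
      }
      where
      singleton⊆L : ∀ {x} → x ∈ L → ⁅ x ⁆ ⊆ L
      singleton⊆L {x} x∈L v∈ = subst (_∈ L) (sym (x∈⁅y⁆⇒x≡y x v∈)) x∈L

      choice : ∀ x → x ∈ L → ∃[ y ] y ∈ R x
      choice x x∈L = y , subst (λ v → y ∈ R v) (x∈⁅y⁆⇒x≡y x v∈) y∈Rv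
        where
        N = neighbourhood R ⁅ x ⁆
        i : Fin ∣ N ∣
        i = fromℕ< (≤-trans (≤-reflexive (sym (∣⁅x⁆∣≡1 x))) (cond ⁅ x ⁆ (singleton⊆L x∈L)))
        y = elem N i
        v = proj₁ (neighbourhood⁻ R ⁅ x ⁆ (elem-∈ N i))
        v∈ = proj₁ (proj₂ (neighbourhood⁻ R ⁅ x ⁆ (elem-∈ N i)))
        y∈Rv = proj₂ (proj₂ (neighbourhood⁻ R ⁅ x ⁆ (elem-∈ N i)))

      unique : ∀ {x y z} → y ∈ R x → z ∈ R x → z ≡ y
      unique {x} {y} {z} y∈ z∈ = decidable-stable (z ≟ y) λ z≢y → ¬branching (x , z , y , z≢y , z∈ , y∈)

      injective : ∀ {x x′} (x∈L : x ∈ L) (x′∈L : x′ ∈ L) →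
                  proj₁ (choice x x∈L) ≡ proj₁ (choice x′ x′∈L) → x ≡ x′
      injective {x} {x′} x∈L x′∈L eq = decidable-stable (x ≟ x′) λ x≢x′ → <⇒≱
        (p⊂q⇒∣p∣<∣q∣ {p = ⁅ x ⁆} {⁅ x ⁆ ∪ ⁅ x′ ⁆}
          (x∈p∪q⁺ ∘ inj₁ , x′ , x∈p∪q⁺ (inj₂ (x∈⁅x⁆ x′)) , x≢x′ ∘ sym ∘ x∈⁅y⁆⇒x≡y x))
        (begin
          ∣ ⁅ x ⁆ ∪ ⁅ x′ ⁆ ∣
            ≤⟨ cond _ ([ singleton⊆L x∈L , singleton⊆L x′∈L ]′ ∘ x∈p∪q⁻ ⁅ x ⁆ ⁅ x′ ⁆) ⟩
          ∣ neighbourhood R (⁅ x ⁆ ∪ ⁅ x′ ⁆) ∣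
            ≤⟨ p⊆q⇒∣p∣≤∣q∣ ⊆-singleton ⟩
          ∣ ⁅ y ⁆ ∣
            ≡⟨ ∣⁅x⁆∣≡1 y ⟩
          1
            ≡⟨ ∣⁅x⁆∣≡1 x ⟨
          ∣ ⁅ x ⁆ ∣ ∎)
        where
        open ≤-Reasoning
        y = proj₁ (choice x x∈L)
        ⊆-singleton : neighbourhood R (⁅ x ⁆ ∪ ⁅ x′ ⁆) ⊆ ⁅ y ⁆
        ⊆-singleton {z} z∈ with neighbourhood⁻ R (⁅ x ⁆ ∪ ⁅ x′ ⁆) z∈
        ... | v , v∈ , z∈Rv = subst (_∈ ⁅ y ⁆) (sym z≡y) (x∈⁅x⁆ y)
          where
          z≡y : z ≡ y
          z≡y with x∈p∪q⁻ ⁅ x ⁆ ⁅ x′ ⁆ v∈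
          ... | inj₁ v∈x = unique (subst (λ v → y ∈ R v) (sym (x∈⁅y⁆⇒x≡y x v∈x)) (proj₂ (choice x x∈L))) z∈Rv
          ... | inj₂ v∈x′ = trans
            (unique (subst (λ v → _ ∈ R v) (sym (x∈⁅y⁆⇒x≡y x′ v∈x′)) (proj₂ (choice x′ x′∈L))) z∈Rv)
            (sym eq)

    go : ∀ R → Acc _<_ (sum (∣_∣ ∘ R)) → HallCondition R L → Matching R L
    go R (acc rec) cond with branching? R
    ... | no ¬branching = nonbranching R ¬branching cond
    ... | yes (x , y₁ , y₂ , y₁≢y₂ , y₁∈ , y₂∈) with removeEdge-HallCondition {R} {L} cond {x} y₁≢y₂
    ...   | inj₁ cond₁ = widen (go _ (rec (removeEdge-< R y₁∈)) cond₁)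
    ...   | inj₂ cond₂ = widen (go _ (rec (removeEdge-< R y₂∈)) cond₂)

-- Disjoint paths

funToFin-cong : ∀ {m n} {f g : Fin m → Fin n} → (∀ i → f i ≡ g i) → funToFin f ≡ funToFin g
funToFin-cong {zero}  eq = refl
funToFin-cong {suc m} eq = cong₂ combine (eq zero) (funToFin-cong (eq ∘ suc))

-- Menger's theorem from Hall's theorem

module _ {t n : ℕ} (G : Network t n) (T : Subset n) where
  open Network G

  private
    isInput? : ∀ v → Dec (∃[ i ] inputs i ≡ v)
    isInput? v = any? (λ i → inputs i ≟ v)

    isTarget? : ∀ v → Dec (∃[ i ] i ∈ T × outputs i ≡ v)
    isTarget? v = any? (λ i → (i ∈? T) ×-dec (outputs i ≟ v))

    -- Targets are excluded because a path does not continue beyond its target. In particular a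
    -- target that is not an input cannot be matched to itself.
    isPredecessor? : ∀ v u → Dec ((u ≡ v ⊎ u ⟶ v) × ¬ (∃[ i ] i ∈ T × outputs i ≡ u))
    isPredecessor? v u = ((u ≟ v) ⊎-dec (u ⟶? v)) ×-dec ¬? (isTarget? u)

  nonInputs targets : Subset labels
  nonInputs = fromPred (¬? ∘ isInput?)
  targets   = fromPred isTarget?

  -- Vertex-disjoint paths from the inputs onto the targets correspond to
  -- matchings of the non-input vertices v along this relation (Ingleton and
  -- Piff): v is matched to its predecessor on the path through v, and to itself
  -- if there is none.
  predecessors : Fin labels → Subset labels
  predecessors v = fromPred (isPredecessor? v)

  module _ (M : Matching predecessors nonInputs) where
    open Matching M

    private
      step : ∀ {v} → v ∈ nonInputs → Fin labels
      step {v} = partner v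

      step-⟶⊎≡ : ∀ {v} (v∈ : v ∈ nonInputs) → step v∈ ≡ v ⊎ step v∈ ⟶ v
      step-⟶⊎≡ {v} v∈ = proj₁ (∈-fromPred⁻ (isPredecessor? v) (partner-∈ v v∈))

      step-¬target : ∀ {v} (v∈ : v ∈ nonInputs) → ¬ (∃[ i ] i ∈ T × outputs i ≡ step v∈)
      step-¬target {v} v∈ = proj₂ (∈-fromPred⁻ (isPredecessor? v) (partner-∈ v v∈))

      -- The path ending in `outputs i`, traced backwards by iterating `step`.
      data Orbit (i : Fin n) : Fin labels → Set where
        start : Orbit i (outputs i)
        next  : ∀ {v u} → Orbit i v → (v∈ : v ∈ nonInputs) → step v∈ ≡ u → Orbit i u

      -- `step` is injective and never yields a target, so two orbits that meet can be unwound in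
      -- parallel until both stand at their starting targets.
      orbits-disjoint : ∀ {i j v w} → i ∈ T → j ∈ T → Orbit i v → Orbit j w → v ≡ w → i ≡ j
      orbits-disjoint i∈T j∈T start         start         v≡w = outputs-injective v≡w
      orbits-disjoint i∈T j∈T start         (next _ v∈ eq) v≡w =
        ⊥-elim (step-¬target v∈ (_ , i∈T , trans v≡w (sym eq)))
      orbits-disjoint i∈T j∈T (next _ v∈ eq) start         v≡w =
        ⊥-elim (step-¬target v∈ (_ , j∈T , trans (sym v≡w) (sym eq)))
      orbits-disjoint i∈T j∈T (next o v∈ eq) (next o′ w∈ eq′) v≡w =
        orbits-disjoint i∈T j∈T o o′ (partner-injective v∈ w∈ (trans eq (trans v≡w (sym eq′))))

      -- By injectivity a fixed vertex can only be reached from itself, so unwinding would lead to a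
      -- fixed target, whereas no target is a value of `step`.
      orbit-unfixed : ∀ {i v} → i ∈ T → Orbit i v → (v∈ : v ∈ nonInputs) → step v∈ ≢ v
      orbit-unfixed i∈T start          v∈ eq = step-¬target v∈ (_ , i∈T , sym eq)
      orbit-unfixed i∈T (next o w∈ eq′) v∈ eq = orbit-unfixed i∈T o w∈
        (trans eq′ (sym (partner-injective w∈ v∈ (trans eq′ (sym eq)))))

      trail-head : ∀ {u v} (p : Star _⟶_ u v) → u List.∈ trail p
      trail-head ε       = here refl
      trail-head (_ ◅ _) = here refl

      trail-snoc : ∀ {u v w x} (p : Star _⟶_ u v) (e : v ⟶ w) →
                   x List.∈ trail (p ◅◅ (e ◅ ε)) → x List.∈ trail p ⊎ x ≡ w
      trail-snoc ε       e (here eq)         = inj₁ (here eq)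
      trail-snoc ε       e (there (here eq)) = inj₂ eq
      trail-snoc (d ◅ p) e (here eq)         = inj₁ (here eq)
      trail-snoc (d ◅ p) e (there x∈)        with trail-snoc p e x∈
      ... | inj₁ x∈p = inj₁ (there x∈p)
      ... | inj₂ x≡w = inj₂ x≡w

      record PathTo (i : Fin n) (v : Fin labels) : Set where
        field
          origin : Fin t
          route  : Star _⟶_ (inputs origin) v
          inside-orbit : ∀ {x} → x List.∈ trail route → Orbit i x
      open PathTo

      -- On an orbit every step is an edge into the current vertex, so by well-foundedness the
      -- backward walk ends, and it can end only at an input.
      pathTo : ∀ {i} → i ∈ T → ∀ v → Acc _⟶_ v → Orbit i v → PathTo i v
      pathTo i∈T v (acc rec) o with isInput? v
      ... | yes (k , refl) = record { origin = k ; route = ε ; inside-orbit = λ { (here refl) → o } }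
      ... | no  ¬input     with v∈ ← ∈-fromPred⁺ (¬? ∘ isInput?) ¬input | step-⟶⊎≡ v∈
      ...   | inj₁ fixed = ⊥-elim (orbit-unfixed i∈T o v∈ fixed)
      ...   | inj₂ e     with P ← pathTo i∈T (step v∈) (rec e) (next o v∈ refl) = record
        { origin       = origin P
        ; route        = route P ◅◅ (e ◅ ε)
        ; inside-orbit = [ inside-orbit P , (λ { refl → o }) ]′ ∘ trail-snoc (route P) e
        }

    matching⇒DisjointPaths : ∣ T ∣ ≡ t → DisjointPaths G T
    matching⇒DisjointPaths refl = record
      { source           = source
      -- Each trail contains its input, so two paths with a common source would meet.
      ; source-injective = λ {i} {j} eq → decidable-stable (i ≟ j) λ i≢j → disjoint i≢j
          ( trail-head (route (paths i))
          , subst (λ k → inputs k List.∈ trail (route (paths j))) (sym eq) (trail-head (route (paths j))))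
      ; target           = elem T
      ; target-injective = elem-injective T
      ; target∈T         = elem-∈ T
      ; path             = λ j → route (paths j)
      ; disjoint         = disjoint
      }
      where
      paths : ∀ j → PathTo (elem T j) (outputs (elem T j))
      paths j = pathTo (elem-∈ T j) _ (⟶-wellFounded _) start
      source : Fin t → Fin t
      source j = origin (paths j)
      disjoint : ∀ {i j} → i ≢ j → ∀ {x} →
                 ¬ (x List.∈ trail (route (paths i)) × x List.∈ trail (route (paths j)))
      disjoint {i} {j} i≢j (x∈i , x∈j) = i≢j (elem-injective T
        (orbits-disjoint (elem-∈ T i) (elem-∈ T j)
          (inside-orbit (paths i) x∈i) (inside-orbit (paths j) x∈j) refl))

  -- Circuit evaluation is abstracted to a valuation indexed by `I`, so that one argument serves
  -- both graphs: after deletion of the secret, `I` consists of the samples with secret 0.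
  module _ {q : ℕ} (1<q : 1 < q) {ℓ} {I : Set ℓ} (val : I → Fin labels → Fin q)
           (local : ∀ {ω ω′} v → (∀ i → inputs i ≢ v) →
                    (∀ u → u ⟶ v → val ω u ≡ val ω′ u) → val ω v ≡ val ω′ v)
           (onto : ∀ (z : Fin ∣ T ∣ → Fin q) → ∃[ ω ] (∀ j → val ω (outputs (elem T j)) ≡ z j))
           where

    -- If X violated Hall's condition, the fewer than ∣ T ∣ vertices of
    -- (neighbourhood X ∪ targets) ─ X would separate the inputs from the targets
    -- and hence determine the values there.
    predecessors-HallCondition : HallCondition predecessors nonInputs
    predecessors-HallCondition X X⊆nonInputs = ≮⇒≥ λ violation →
      -- The `q ^ ∣ T ∣` tuples of target values are encoded injectively by their values on the cut,
      -- of which there are strictly fewer.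
      <⇒≱ (^-monoʳ-< q 1<q (∣cut∣<∣T∣ violation)) (injective⇒≤ encode-injective)
      where
      N U cut : Subset labels
      N   = neighbourhood predecessors X
      U   = N ∪ targets
      cut = U ─ X

      target∈U : ∀ {v} → ∃[ i ] i ∈ T × outputs i ≡ v → v ∈ U
      target∈U = x∈p∪q⁺ ∘ inj₂ ∘ ∈-fromPred⁺ isTarget?

      predecessor∈U : ∀ {v u} → v ∈ X → u ≡ v ⊎ u ⟶ v → u ∈ U
      predecessor∈U {v} {u} v∈X u⟶v with isTarget? u
      ... | yes target = target∈U target
      ... | no ¬target = x∈p∪q⁺ (inj₁ (neighbourhood⁺ predecessors v∈X
                           (∈-fromPred⁺ (isPredecessor? v) (u⟶v , ¬target))))

      -- Each vertex of `X` is its own predecessor or a target, so `X` lies in `U` and the cut has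
      -- exactly `∣ X ∣` fewer elements than `U`.
      ∣cut∣<∣T∣ : ∣ N ∣ < ∣ X ∣ → ∣ cut ∣ < ∣ T ∣
      ∣cut∣<∣T∣ violation = +-cancelʳ-< ∣ X ∣ _ _ (begin-strict
        ∣ cut ∣ + ∣ X ∣        ≡⟨ q⊆p⇒∣p─q∣+∣q∣≡∣p∣ (λ x∈X → predecessor∈U x∈X (inj₁ refl)) ⟩
        ∣ U ∣                  ≤⟨ ∣p∪q∣≤∣p∣+∣q∣ N targets ⟩
        ∣ N ∣ + ∣ targets ∣    ≤⟨ +-monoʳ-≤ ∣ N ∣ (∣p∣≤-covered targets (outputs ∘ elem T) cover) ⟩
        ∣ N ∣ + ∣ T ∣          <⟨ +-monoˡ-< ∣ T ∣ violation ⟩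
        ∣ X ∣ + ∣ T ∣          ≡⟨ +-comm ∣ X ∣ ∣ T ∣ ⟩
        ∣ T ∣ + ∣ X ∣          ∎)
        where
        open ≤-Reasoning
        cover : ∀ {v} → v ∈ targets → ∃[ j ] outputs (elem T j) ≡ v
        cover v∈ with i , i∈T , eq ← ∈-fromPred⁻ isTarget? v∈ with j , refl ← elem-surjective T i∈T = j , eq

      -- Well-founded induction: a vertex of `U` outside `X` is in the cut, and one in `X` is not an
      -- input and has all its in-neighbours in `U`.
      determined : ∀ {ω ω′} → (∀ {v} → v ∈ cut → val ω v ≡ val ω′ v) →
                   ∀ v → Acc _⟶_ v → v ∈ U → val ω v ≡ val ω′ v
      determined agree v (acc rec) v∈U with v ∈? X
      ... | no  v∉X = agree (x∈p∧x∉q⇒x∈p─q v∈U v∉X)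
      ... | yes v∈X = local v (λ i eq → ∈-fromPred⁻ (¬? ∘ isInput?) (X⊆nonInputs v∈X) (i , eq))
                        λ u u⟶v → determined agree u (rec u⟶v) (predecessor∈U v∈X (inj₂ u⟶v))

      witness : Fin (q ^ ∣ T ∣) → I
      witness c = proj₁ (onto (finToFun {q} {∣ T ∣} c))

      encode : Fin (q ^ ∣ T ∣) → Fin (q ^ ∣ cut ∣)
      encode c = funToFin (λ d → val (witness c) (elem cut d))

      encode-injective : ∀ {c c′} → encode c ≡ encode c′ → c ≡ c′
      encode-injective {c} {c′} eq = begin
        c                                        ≡⟨ funToFin-finToFin {∣ T ∣} {q} c ⟨
        funToFin (finToFun {q} {∣ T ∣} c)        ≡⟨ funToFin-cong values-agree ⟩
        funToFin (finToFun {q} {∣ T ∣} c′)       ≡⟨ funToFin-finToFin {∣ T ∣} {q} c′ ⟩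
        c′                                       ∎
        where
        open ≡-Reasoning
        cut-agree : ∀ {v} → v ∈ cut → val (witness c) v ≡ val (witness c′) v
        cut-agree v∈ with d , refl ← elem-surjective cut v∈ = begin
          val (witness c) (elem cut d)   ≡⟨ finToFun-funToFin _ d ⟨
          finToFun (encode c) d          ≡⟨ cong (λ k → finToFun k d) eq ⟩
          finToFun (encode c′) d         ≡⟨ finToFun-funToFin _ d ⟩
          val (witness c′) (elem cut d)  ∎
        values-agree : ∀ j → finToFun {q} {∣ T ∣} c j ≡ finToFun {q} {∣ T ∣} c′ j
        values-agree j = begin
          finToFun {q} {∣ T ∣} c j
            ≡⟨ proj₂ (onto (finToFun {q} {∣ T ∣} c)) j ⟨
          val (witness c) (outputs (elem T j))
            ≡⟨ determined cut-agree _ (⟶-wellFounded _) (target∈U (_ , elem-∈ T j , refl)) ⟩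
          val (witness c′) (outputs (elem T j))
            ≡⟨ proj₂ (onto (finToFun {q} {∣ T ∣} c′)) j ⟩
          finToFun {q} {∣ T ∣} c′ j ∎

    onto⇒DisjointPaths : ∣ T ∣ ≡ t → DisjointPaths G T
    onto⇒DisjointPaths = matching⇒DisjointPaths (hall predecessors-HallCondition)

-- Secret sharing

-- Punching out a missed value would leave an injection of `Fin (suc n)` into `Fin n`.
injective⇒surjective : ∀ {n} {f : Fin n → Fin n} → Injective _≡_ _≡_ f → ∀ y → ∃[ x ] f x ≡ y
injective⇒surjective {suc n} {f} f-inj y with any? (λ x → f x ≟ y)
... | yes hit = hit
... | no ¬hit = contradiction
  (injective⇒≤ {f = λ x → punchOut (y≢f x)} λ eq → f-inj (punchOut-injective (y≢f _) (y≢f _) eq))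
  1+n≰n
  where
  y≢f : ∀ x → y ≢ f x
  y≢f x y≡fx = ¬hit (x , sym y≡fx)

map-≡⇒≡ : ∀ {a b} {A : Set a} {B : Set b} {f g : A → B} {xs x} →
          List.map f xs ≡ List.map g xs → x List.∈ xs → f x ≡ g x
map-≡⇒≡ {xs = _ ∷ _} eq (here refl) = ∷-injectiveˡ eq
map-≡⇒≡ {xs = _ ∷ _} eq (there x∈)  = map-≡⇒≡ (∷-injectiveʳ eq) x∈

-- Finite fields and locality of circuit values

module _ {a} (F : FiniteField a) where
  open FiniteField F using (Carrier; order; element; enumeration; isField; 0#; 1#)
  open IsHeytingField isField using (invertible⇒#; zeroˡ; zeroʳ)

  index : Carrier → Fin order
  index = Inverse.to enumeration

  element-index : ∀ x → element (index x) ≡ x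
  element-index = Inverse.strictlyInverseʳ enumeration

  index-element : ∀ i → index (element i) ≡ i
  index-element = Inverse.strictlyInverseˡ enumeration

  index-injective : ∀ {x y} → index x ≡ index y → x ≡ y
  index-injective {x} {y} eq = trans (sym (element-index x)) (trans (cong element eq) (element-index y))

  -- Otherwise 0 - 0 would be invertible, with inverse 0, which would make 0 apart from itself.
  0≢1 : 0# ≢ 1#
  0≢1 0≡1 = invertible⇒# {0#} {0#} (0# , trans (zeroˡ _) 0≡1 , trans (zeroʳ _) 0≡1) refl

  1<order : 1 < order
  1<order = ≰⇒> λ order≤1 → 0≢1 (index-injective (Fin-≤1 order≤1 (index 0#) (index 1#)))
    where
    Fin-≤1 : ∀ {m} → m ≤ 1 → (i j : Fin m) → i ≡ j
    Fin-≤1 (s≤s z≤n) zero zero = refl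

  Carrier-injective⇒surjective : ∀ {f : Carrier → Carrier} → Injective _≡_ _≡_ f → ∀ y → ∃[ x ] f x ≡ y
  Carrier-injective⇒surjective {f} f-inj y
    with i , eq ← injective⇒surjective {f = index ∘ f ∘ element}
                    (λ {i} {j} eq → trans (sym (index-element i))
                      (trans (cong index (f-inj (index-injective eq))) (index-element j)))
                    (index y)
    = element i , index-injective eq

  value-local : ∀ {t n} (C : Circuit F t n) → let open Circuit C in
    ∀ {x x′} v → (∀ i → inputs i ≢ v) → (∀ u → u ⟶ v → value x u ≡ value x′ u) → value x v ≡ value x′ v
  value-local C {x} {x′} v ¬input agree = begin
    value x v
      ≡⟨ value-gate x v ¬input ⟩
    gate v (Vec.tabulate (value x ∘ inNeighbour v))
      ≡⟨ cong (gate v) (tabulate-cong λ j → agree _ (inNeighbour-⟶ v j)) ⟩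
    gate v (Vec.tabulate (value x′ ∘ inNeighbour v))
      ≡⟨ value-gate x′ v ¬input ⟨
    value x′ v ∎
    where
    open Circuit C
    open ≡-Reasoning

-- Attainable shares and the two concentrators

module _ {a} (F : FiniteField a) {k n : ℕ} (C : Circuit F (suc k) n)
         (computes : ComputesThresholdShares F C) where
  open FiniteField F using (Carrier; order; element; enumeration; 0#) renaming (_≟_ to _≟ꟳ_)
  open Circuit C
  open ComputesThresholdShares computes

  private
    Secret : Ω F C → Carrier
    Secret = S F C

    Share : Ω F C → Fin n → Carrier
    Share = Y F C

    Shares : Subset n → Ω F C → List Carrier
    Shares = Y[_] F C

    instance
      ∣Ω∣-nonZero : NonZero (order ^ suc k)
      ∣Ω∣-nonZero = ∣Ω∣≢0 F C

  Shares-cong : ∀ T {ω ω′} → (∀ {i} → i ∈ T → Share ω i ≡ Share ω′ i) → Shares T ω ≡ Shares T ω′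
  Shares-cong T eq = map-cong-local (All.map eq (all-filter (_∈? T) (List.allFin n)))

  Shares-injective : ∀ T {ω ω′} → Shares T ω ≡ Shares T ω′ → ∀ {i} → i ∈ T → Share ω i ≡ Share ω′ i
  Shares-injective T eq {i} i∈T = map-≡⇒≡ eq (∈-filter⁺ (_∈? T) (∈-allFin i) i∈T)

  Secret-surjective : ∀ s → ∃[ ω ] Secret ω ≡ s
  Secret-surjective s = funToFin {suc k} (λ _ → index F s) ,
    trans (cong element (finToFun-funToFin {suc k} (λ _ → index F s) zero)) (element-index F s)

  shares-determine-secret : ∀ T → ∣ T ∣ ≡ suc k → ∀ {ω ω′} →
    (∀ {i} → i ∈ T → Share ω i ≡ Share ω′ i) → Secret ω ≡ Secret ω′
  shares-determine-secret T ∣T∣≡t eq = conditionalEntropy≃0⇒determined _≟ꟳ_ (≡-dec _≟ꟳ_)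
    Secret (Shares T) (correctness T ∣T∣≡t) (Shares-cong T eq)

  secret-independent-of-shares : ∀ T → ∣ T ∣ ≡ k → ∀ ω s →
    ∃[ ω′ ] Secret ω′ ≡ s × (∀ {i} → i ∈ T → Share ω′ i ≡ Share ω i)
  secret-independent-of-shares T ∣T∣≡k ω s
    with ωₛ , refl ← Secret-surjective s
    with ω′ , secret , shares ← conditionalEntropy≃entropy⇒jointly-attained _≟ꟳ_ (≡-dec _≟ꟳ_)
           Secret (Shares T) (privacy T ∣T∣≡k) ωₛ ω
    = ω′ , secret , Shares-injective T shares

  -- With the other shares in T fixed, the secret s is still arbitrary by privacy,
  -- and by correctness s ↦ share x is injective, hence onto.
  adjust-share : ∀ T → ∣ T ∣ ≡ suc k → ∀ {x} → x ∈ T → ∀ ω y →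
    ∃[ ω′ ] Share ω′ x ≡ y × (∀ {i} → i ∈ T → i ≢ x → Share ω′ i ≡ Share ω i)
  adjust-share T ∣T∣≡t {x} x∈T ω y =
    let (s , eq) = Carrier-injective⇒surjective F share-injective y in
    proj₁ (variant s) , eq , λ i∈T i≢x → proj₂ (proj₂ (variant s)) (x∈p∧x≢y⇒x∈p-y i∈T i≢x)
    where
    variant : ∀ s → ∃[ ω′ ] Secret ω′ ≡ s × (∀ {i} → i ∈ T - x → Share ω′ i ≡ Share ω i)
    variant = secret-independent-of-shares (T - x) (cong pred (trans (x∈p⇒1+∣p-x∣≡∣p∣ x∈T) ∣T∣≡t)) ω

    share : Carrier → Carrier
    share s = Share (proj₁ (variant s)) x

    share-injective : Injective _≡_ _≡_ share
    share-injective {s} {s′} eq = begin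
      s                             ≡⟨ proj₁ (proj₂ (variant s)) ⟨
      Secret (proj₁ (variant s))    ≡⟨ shares-determine-secret T ∣T∣≡t agree ⟩
      Secret (proj₁ (variant s′))   ≡⟨ proj₁ (proj₂ (variant s′)) ⟩
      s′                            ∎
      where
      open ≡-Reasoning
      agree : ∀ {i} → i ∈ T → Share (proj₁ (variant s)) i ≡ Share (proj₁ (variant s′)) i
      agree {i} i∈T with i ≟ x
      ... | yes refl = eq
      ... | no  i≢x  = trans (proj₂ (proj₂ (variant s)) i∈T-x) (sym (proj₂ (proj₂ (variant s′)) i∈T-x))
        where i∈T-x = x∈p∧x≢y⇒x∈p-y i∈T i≢x

  -- Induction over the list of all indices: `adjust-share` corrects the share at the head and keeps
  -- the other shares in `T`, hence also those corrected before.
  shares-onto : ∀ T → ∣ T ∣ ≡ suc k → ∀ (z : Fin n → Carrier) → ∃[ ω ] (∀ {i} → i ∈ T → Share ω i ≡ z i)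
  shares-onto T ∣T∣≡t z = let (ω , eq) = go (List.allFin n) in ω , eq (∈-allFin _)
    where
    Agrees : List (Fin n) → Ω F C → Set a
    Agrees xs ω = ∀ {i} → i List.∈ xs → i ∈ T → Share ω i ≡ z i

    go : ∀ xs → ∃[ ω ] Agrees xs ω
    step : ∀ x xs → ∃[ ω ] Agrees xs ω → Dec (x ∈ T) → ∃[ ω ] Agrees (x ∷ xs) ω

    go []       = proj₁ (Secret-surjective 0#) , λ ()
    go (x ∷ xs) = step x xs (go xs) (x ∈? T)

    step x xs (ω , eq) (no  x∉T) = ω , λ
      { (here refl)  i∈T → contradiction i∈T x∉T
      ; (there i∈xs) i∈T → eq i∈xs i∈T }
    step x xs (ω , eq) (yes x∈T) = let (ω′ , eqx , keep) = adjust-share T ∣T∣≡t x∈T ω (z x) in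
      ω′ , λ {i} → eq′ ω′ eqx keep i (i ≟ x)
      where
      -- Whether `i` is `x` is decided before the membership is inspected, because `x` might occur
      -- again in `xs`.
      eq′ : ∀ ω′ → Share ω′ x ≡ z x → (∀ {i} → i ∈ T → i ≢ x → Share ω′ i ≡ Share ω i) →
            ∀ i → Dec (i ≡ x) → i List.∈ x ∷ xs → i ∈ T → Share ω′ i ≡ z i
      eq′ ω′ eqx keep i (yes refl) _            _   = eqx
      eq′ ω′ eqx keep i (no  i≢x)  (here i≡x)   _   = contradiction i≡x i≢x
      eq′ ω′ eqx keep i (no  i≢x)  (there i∈xs) i∈T = trans (keep i∈T i≢x) (eq i∈xs i∈T)

  -- One index outside `T`, available as `k < n`, completes `T` to a set on which all values are
  -- attained. Privacy then changes the secret to `s` while keeping the shares in `T`.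
  shares-onto-given-secret : k < n → ∀ T → ∣ T ∣ ≡ k → ∀ s (z : Fin n → Carrier) →
    ∃[ ω ] Secret ω ≡ s × (∀ {i} → i ∈ T → Share ω i ≡ z i)
  shares-onto-given-secret k<n T ∣T∣≡k s z
    with x , x∉T ← ∣p∣<n⇒∃x∉p T (subst (_< n) (sym ∣T∣≡k) k<n)
    with ω , eq ← shares-onto (T ∪ ⁅ x ⁆) (trans (x∉p⇒∣p∪⁅x⁆∣≡1+∣p∣ x∉T) (cong suc ∣T∣≡k)) z
    with ω′ , secret , shares ← secret-independent-of-shares T ∣T∣≡k ω s
    = ω′ , secret , λ i∈T → trans (shares i∈T) (eq (x∈p∪q⁺ (inj₁ i∈T)))

  private
    extend : ∀ (T : Subset n) → (Fin ∣ T ∣ → Fin order) → Fin n → Carrier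
    extend T z i with i ∈? T
    ... | yes i∈T = element (z (proj₁ (elem-surjective T i∈T)))
    -- An arbitrary default: shares are compared with `extend T z` only at indices in `T`.
    ... | no  _   = 0#

    extend-elem : ∀ T z j → extend T z (elem T j) ≡ element (z j)
    extend-elem T z j with elem T j ∈? T
    ... | yes e∈T = cong (element ∘ z) (elem-injective T (proj₂ (elem-surjective T e∈T)))
    ... | no  e∉T = contradiction (elem-∈ T j) e∉T

    index-share : ∀ T z {ω} → (∀ {i} → i ∈ T → Share ω i ≡ extend T z i) →
                  ∀ j → index F (Share ω (elem T j)) ≡ z j
    index-share T z eq j = trans (cong (index F) (trans (eq (elem-∈ T j)) (extend-elem T z j)))
                                  (index-element F (z j))

    input : Ω F C → Fin (suc k) → Carrier
    input = inputValues F C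

  network-isConcentrator : suc k ≤ n → IsConcentrator network
  network-isConcentrator t≤n = t≤n , λ T ∣T∣≡t → onto⇒DisjointPaths network T (1<order F)
    (λ ω v → index F (value (input ω) v))
    (λ v ¬input agree → cong (index F) (value-local F C v ¬input λ u e → index-injective F (agree u e)))
    (λ z → let (ω , eq) = shares-onto T ∣T∣≡t (extend T z) in ω , index-share T z eq)
    ∣T∣≡t

  -- Fixing the secret to 0 makes the value at the deleted vertex a constant.
  deleteFirstInput-isConcentrator : suc k ≤ n → IsConcentrator (deleteFirstInput network)
  deleteFirstInput-isConcentrator t≤n = <⇒≤ t≤n , λ T ∣T∣≡k →
    onto⇒DisjointPaths (deleteFirstInput network) T (1<order F) val (λ {ω} {ω′} → local {ω} {ω′})
      (λ z → let (ω , secret , eq) = shares-onto-given-secret t≤n T ∣T∣≡k 0# (extend T z) in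
             (ω , secret) , index-share T z eq)
      ∣T∣≡k
    where
    val : (∃[ ω ] Secret ω ≡ 0#) → Fin labels → Fin order
    val (ω , _) v = index F (value (input ω) v)

    secret-value : ∀ ((ω , _) (ω′ , _) : ∃[ ω ] Secret ω ≡ 0#) →
                   value (input ω) (inputs zero) ≡ value (input ω′) (inputs zero)
    secret-value (ω , Sω≡0) (ω′ , Sω′≡0) = begin
      value (input ω) (inputs zero)   ≡⟨ value-input (input ω) zero ⟩
      Secret ω                        ≡⟨ trans Sω≡0 (sym Sω′≡0) ⟩
      Secret ω′                       ≡⟨ value-input (input ω′) zero ⟨
      value (input ω′) (inputs zero)  ∎
      where open ≡-Reasoning

    -- The deleted vertex is no longer an input here, so locality must hold at it as well, and the
    -- edges leaving it are missing from the hypothesis. Its constant value settles both.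
    local : ∀ {ω ω′} v → (∀ i → inputs (suc i) ≢ v) →
            (∀ u → u ⟶ v × u ≢ inputs zero × v ≢ inputs zero → val ω u ≡ val ω′ u) → val ω v ≡ val ω′ v
    local {ω} {ω′} v ¬input agree with v ≟ inputs zero
    ... | yes refl = cong (index F) (secret-value ω ω′)
    ... | no  v≢s  = cong (index F) (value-local F C v
      (λ { zero eq → v≢s (sym eq) ; (suc i) → ¬input i }) agree′)
      where
      agree′ : ∀ u → u ⟶ v → value (input (proj₁ ω)) u ≡ value (input (proj₁ ω′)) u
      agree′ u e with u ≟ inputs zero
      ... | yes refl = secret-value ω ω′
      ... | no  u≢s  = index-injective F (agree u (e , u≢s , v≢s))

theorem1 : ∀ {a} (F : FiniteField a) (t-1 n : ℕ) → let t = suc t-1 in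
    t ≤ n → (C : Circuit F t n) → ComputesThresholdShares F C →
    IsConcentrator (Circuit.network C) × IsConcentrator (deleteFirstInput (Circuit.network C))
theorem1 F t-1 n t≤n C computes =
  network-isConcentrator F C computes t≤n , deleteFirstInput-isConcentrator F C computes t≤n
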